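{- Let $n \geq 5$ be an integer and let $\Gamma = KG(n,2)$ be the Kneser graph on the $2$-subsets of an $n$-element set. Then the critical group $K(\Gamma)$ of $\Gamma$ satisfies \[ K(\Gamma) \cong \mathbf{Z}_{n-4} \oplus \left( \mathbf{Z}_{\frac{(n-4)(n-1)}{2}} \right)^{\frac{n(n-5)}{2}} \oplus \mathbf{Z}_{\frac{(n-4)(n-1)(n-3)}{4}} \oplus \left( \mathbf{Z}_{\frac{(n-4)(n-1)(n-3)n}{4}} \right)^{n-2} \quad \text{if $n$ is odd,} \] and \[ K(\Gamma) \cong \mathbf{Z}_{\frac{n-4}{2}} \oplus \left( \mathbf{Z}_{\frac{(n-4)(n-1)}{2}} \right)^{\frac{n(n-5)}{2}} \oplus \mathbf{Z}_{\frac{(n-4)(n-1)(n-3)}{2}} \oplus \left( \mathbf{Z}_{\frac{(n-4)(n-1)(n-3)n}{4}} \right)^{n-2} \quad \text{if $n$ is even.} \]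
   Context: For a positive integer $m$, $\mathbf{Z}_m$ denotes the cyclic group $\mathbb{Z}/m\mathbb{Z}$, and for a group $G$ and an integer $k \geq 0$, $G^k$ denotes the direct sum of $k$ copies of $G$ (trivial when $k=0$). The Kneser graph $KG(n,2)$ is the simple graph whose vertices are the $2$-element subsets of an $n$-element set, two vertices being adjacent if and only if the corresponding subsets are disjoint. For a finite graph $\Gamma$ with vertex set $V(\Gamma)$, let $A$ be its adjacency matrix and $D$ the diagonal matrix whose diagonal entries are the vertex degrees. The Laplacian matrix is $L = D - A$, viewed as a homomorphism of free abelian groups $L \colon \mathbb{Z}^{V(\Gamma)} \to \mathbb{Z}^{V(\Gamma)}$. The critical group $K(\Gamma)$ is the torsion subgroup of the cokernel $\mathbb{Z}^{V(\Gamma)} / \operatorname{Im}(L)$. -}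

module Defs where

open import Level using (Level; 0ℓ; _⊔_)
open import Algebra.Bundles using (AbelianGroup)
open import Algebra.Morphism.Bundles using (GroupHomomorphism)
open import Algebra.Morphism.Structures using (IsGroupIsomorphism)
import Algebra.Construct.DirectProduct as DirectProduct
import Algebra.Construct.Pointwise as Pointwise
import Algebra.Properties.AbelianGroup as AbelianGroupProperties
import Algebra.Properties.CommutativeMonoid.Mult as Mult
import Algebra.Properties.CommutativeSemigroup as CommutativeSemigroupProperties
open import Data.Bool.Base using (if_then_else_)
import Data.Bool.Properties as Bool
open import Data.Fin.Base using (Fin)
open import Data.Fin.Subset using (Subset; inside; outside; ∣_∣; _∩_; Empty)
open import Data.Fin.Subset.Properties using (nonempty?; ∩-comm; ∩-idem; Empty-unique; ∣⊥∣≡0)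
import Data.Integer.Properties as ℤ
open import Data.List.Base using (List; []; _∷_; [_]; map; _++_; filter; length; foldr)
open import Data.List.Membership.Propositional using (_∈_)
open import Data.List.Membership.Propositional.Properties using (∈-map⁺; ∈-map⁻; ∈-++⁺ˡ; ∈-++⁺ʳ)
open import Data.List.Relation.Unary.All using ([])
open import Data.List.Relation.Unary.Any using (here)
open import Data.List.Relation.Unary.AllPairs using ([]; _∷_)
open import Data.List.Relation.Unary.Unique.Propositional using (Unique)
open import Data.List.Relation.Unary.Unique.Propositional.Properties using (map⁺; ++⁺)
open import Data.Nat.Base using (ℕ; zero; suc; NonZero)
import Data.Nat.Base as ℕ
import Data.Nat.Properties as ℕ
open import Data.Product.Base using (Σ; Σ-syntax; ∃-syntax; _×_; _,_; proj₁; proj₂)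
open import Data.Vec.Base using ([]; _∷_)
open import Data.Vec.Properties using (≡-dec; ∷-injectiveʳ)
open import Function.Base using (_∘_)
open import Relation.Binary.Core using (Rel)
open import Relation.Binary.Definitions using (Decidable; DecidableEquality; Symmetric; Irreflexive)
open import Relation.Nullary.Decidable using (⌊_⌋; ¬?; map′)

private
  variable
    a b ℓ₁ ℓ₂ : Level

------------------------------------------------------------------------
-- Abelian groups

infix 4 _≅_

_≅_ : AbelianGroup a ℓ₁ → AbelianGroup b ℓ₂ → Set (a ⊔ b ⊔ ℓ₁ ⊔ ℓ₂)
G ≅ H = ∃[ f ] IsGroupIsomorphism G.rawGroup H.rawGroup f
  where
  module G = AbelianGroup G
  module H = AbelianGroup H

infixr 6 _⊕_

_⊕_ : AbelianGroup a ℓ₁ → AbelianGroup b ℓ₂ → AbelianGroup (a ⊔ b) (ℓ₁ ⊔ ℓ₂)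
_⊕_ = DirectProduct.abelianGroup

-- A finite direct sum is a finite product, so Gᵏ is the group of functions
-- Fin k → G.

infixr 8 _^_

_^_ : AbelianGroup a ℓ₁ → ℕ → AbelianGroup a ℓ₁
G ^ k = Pointwise.abelianGroup (Fin k) G

Hom : AbelianGroup a ℓ₁ → AbelianGroup b ℓ₂ → Set (a ⊔ b ⊔ ℓ₁ ⊔ ℓ₂)
Hom G H = GroupHomomorphism (AbelianGroup.rawGroup G) (AbelianGroup.rawGroup H)

-- The quotient H / Im φ has the elements of H, identified when their
-- difference lies in the image of φ.

module _ (G : AbelianGroup a ℓ₁) (H : AbelianGroup b ℓ₂) (φ : Hom G H) where

  private
    module G = AbelianGroup G
    open AbelianGroup H
    open AbelianGroupProperties H using (⁻¹-∙-comm; ⁻¹-anti-homo‿-; x≈y⇒x∙y⁻¹≈ε)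
    open CommutativeSemigroupProperties commutativeSemigroup using (interchange)
    open import Relation.Binary.Reasoning.Setoid setoid
    module φ = GroupHomomorphism φ

  infix 4 _≈Im_

  _≈Im_ : Rel Carrier (a ⊔ ℓ₂)
  x ≈Im y = ∃[ g ] x - y ≈ φ.⟦ g ⟧

  private
    ≈⇒≈Im : ∀ {x y} → x ≈ y → x ≈Im y
    ≈⇒≈Im x≈y = G.ε , trans (x≈y⇒x∙y⁻¹≈ε x≈y) (sym φ.ε-homo)

    ≈Im-sym : ∀ {x y} → x ≈Im y → y ≈Im x
    ≈Im-sym {x} {y} (g , p) = g G.⁻¹ , (begin
      y - x           ≈⟨ ⁻¹-anti-homo‿- x y ⟨
      (x - y) ⁻¹      ≈⟨ ⁻¹-cong p ⟩
      φ.⟦ g ⟧ ⁻¹      ≈⟨ φ.⁻¹-homo g ⟨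
      φ.⟦ g G.⁻¹ ⟧    ∎)

    ≈Im-trans : ∀ {x y z} → x ≈Im y → y ≈Im z → x ≈Im z
    ≈Im-trans {x} {y} {z} (g , p) (h , q) = g G.∙ h , (begin
      x - z                    ≈⟨ ∙-congʳ (identityʳ x) ⟨
      (x ∙ ε) - z              ≈⟨ ∙-congʳ (∙-congˡ (inverseˡ y)) ⟨
      (x ∙ (y ⁻¹ ∙ y)) - z     ≈⟨ ∙-congʳ (assoc x (y ⁻¹) y) ⟨
      ((x - y) ∙ y) - z        ≈⟨ assoc (x - y) y (z ⁻¹) ⟩
      (x - y) ∙ (y - z)        ≈⟨ ∙-cong p q ⟩
      φ.⟦ g ⟧ ∙ φ.⟦ h ⟧        ≈⟨ φ.homo g h ⟨
      φ.⟦ g G.∙ h ⟧            ∎)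

    ≈Im-∙-cong : ∀ {x y u v} → x ≈Im y → u ≈Im v → (x ∙ u) ≈Im (y ∙ v)
    ≈Im-∙-cong {x} {y} {u} {v} (g , p) (h , q) = g G.∙ h , (begin
      (x ∙ u) - (y ∙ v)        ≈⟨ ∙-congˡ (⁻¹-∙-comm y v) ⟨
      (x ∙ u) ∙ (y ⁻¹ ∙ v ⁻¹)  ≈⟨ interchange x u (y ⁻¹) (v ⁻¹) ⟩
      (x - y) ∙ (u - v)        ≈⟨ ∙-cong p q ⟩
      φ.⟦ g ⟧ ∙ φ.⟦ h ⟧        ≈⟨ φ.homo g h ⟨
      φ.⟦ g G.∙ h ⟧            ∎)

    ≈Im-⁻¹-cong : ∀ {x y} → x ≈Im y → (x ⁻¹) ≈Im (y ⁻¹)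
    ≈Im-⁻¹-cong {x} {y} (g , p) = g G.⁻¹ , (begin
      x ⁻¹ - y ⁻¹     ≈⟨ ⁻¹-∙-comm x (y ⁻¹) ⟩
      (x - y) ⁻¹      ≈⟨ ⁻¹-cong p ⟩
      φ.⟦ g ⟧ ⁻¹      ≈⟨ φ.⁻¹-homo g ⟨
      φ.⟦ g G.⁻¹ ⟧    ∎)

  cokernel : AbelianGroup b (a ⊔ ℓ₂)
  cokernel = record
    { Carrier = Carrier
    ; _≈_     = _≈Im_
    ; _∙_     = _∙_
    ; ε       = ε
    ; _⁻¹     = _⁻¹
    ; isAbelianGroup = record
      { isGroup = record
        { isMonoid = record
          { isSemigroup = record
            { isMagma = record
              { isEquivalence = record
                { refl  = ≈⇒≈Im refl
                ; sym   = ≈Im-sym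
                ; trans = ≈Im-trans
                }
              ; ∙-cong = ≈Im-∙-cong
              }
            ; assoc = λ x y z → ≈⇒≈Im (assoc x y z)
            }
          ; identity = (λ x → ≈⇒≈Im (identityˡ x)) , (λ x → ≈⇒≈Im (identityʳ x))
          }
        ; inverse = (λ x → ≈⇒≈Im (inverseˡ x)) , (λ x → ≈⇒≈Im (inverseʳ x))
        ; ⁻¹-cong = ≈Im-⁻¹-cong
        }
      ; comm = λ x y → ≈⇒≈Im (comm x y)
      }
    }

-- An element of the torsion subgroup carries a witness that some positive
-- multiple of it vanishes; equality ignores the witness.

module _ (G : AbelianGroup a ℓ₁) where

  open AbelianGroup G
  open Mult commutativeMonoid using (×-congʳ; ×-assocˡ; ×-congˡ; ×-distrib-+)
    renaming (_×_ to _·_)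
  open import Relation.Binary.Reasoning.Setoid setoid

  IsTorsion : Carrier → Set ℓ₁
  IsTorsion x = ∃[ k ] NonZero k × k · x ≈ ε

  private
    ·-ε : ∀ k → k · ε ≈ ε
    ·-ε zero    = refl
    ·-ε (suc k) = trans (identityˡ (k · ε)) (·-ε k)

    ·-kills : ∀ j {k x} → k · x ≈ ε → (j ℕ.* k) · x ≈ ε
    ·-kills j {k} {x} p = begin
      (j ℕ.* k) · x  ≈⟨ ×-assocˡ x j k ⟨
      j · (k · x)    ≈⟨ ×-congʳ j p ⟩
      j · ε          ≈⟨ ·-ε j ⟩
      ε              ∎

    torsion-ε : IsTorsion ε
    torsion-ε = 1 , _ , ·-ε 1

    torsion-∙ : ∀ {x y} → IsTorsion x → IsTorsion y → IsTorsion (x ∙ y)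
    torsion-∙ {x} {y} (j , j≢0 , p) (k , k≢0 , q) = j ℕ.* k , ℕ.m*n≢0 j k {{j≢0}} {{k≢0}} , (begin
      (j ℕ.* k) · (x ∙ y)                ≈⟨ ×-distrib-+ x y (j ℕ.* k) ⟩
      (j ℕ.* k) · x ∙ (j ℕ.* k) · y      ≈⟨ ∙-congʳ (×-congˡ {x} (ℕ.*-comm j k)) ⟩
      (k ℕ.* j) · x ∙ (j ℕ.* k) · y      ≈⟨ ∙-cong (·-kills k p) (·-kills j q) ⟩
      ε ∙ ε                              ≈⟨ identityˡ ε ⟩
      ε                                  ∎)

    torsion-⁻¹ : ∀ {x} → IsTorsion x → IsTorsion (x ⁻¹)
    torsion-⁻¹ {x} (k , k≢0 , p) = k , k≢0 , (begin
      k · (x ⁻¹)            ≈⟨ identityˡ (k · (x ⁻¹)) ⟨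
      ε ∙ k · (x ⁻¹)        ≈⟨ ∙-congʳ p ⟨
      k · x ∙ k · (x ⁻¹)    ≈⟨ ×-distrib-+ x (x ⁻¹) k ⟨
      k · (x ∙ x ⁻¹)        ≈⟨ ×-congʳ k (inverseʳ x) ⟩
      k · ε                 ≈⟨ ·-ε k ⟩
      ε                     ∎)

  torsionSubgroup : AbelianGroup (a ⊔ ℓ₁) ℓ₁
  torsionSubgroup = record
    { Carrier = Σ Carrier IsTorsion
    ; _≈_     = λ x y → proj₁ x ≈ proj₁ y
    ; _∙_     = λ (x , p) (y , q) → x ∙ y , torsion-∙ p q
    ; ε       = ε , torsion-ε
    ; _⁻¹     = λ (x , p) → x ⁻¹ , torsion-⁻¹ p
    ; isAbelianGroup = record
      { isGroup = record
        { isMonoid = record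
          { isSemigroup = record
            { isMagma = record
              { isEquivalence = record { refl = refl ; sym = sym ; trans = trans }
              ; ∙-cong = ∙-cong
              }
            ; assoc = λ (x , _) (y , _) (z , _) → assoc x y z
            }
          ; identity = (λ (x , _) → identityˡ x) , (λ (x , _) → identityʳ x)
          }
        ; inverse = (λ (x , _) → inverseˡ x) , (λ (x , _) → inverseʳ x)
        ; ⁻¹-cong = ⁻¹-cong
        }
      ; comm = λ (x , _) (y , _) → comm x y
      }
    }

open import Data.Integer.Base using (ℤ; +_; 0ℤ; 1ℤ; _+_; _-_; _*_; -_)
open import Relation.Binary.PropositionalEquality
  using (_≡_; _≢_; refl; sym; trans; cong; cong₂; subst; module ≡-Reasoning)

mulBy : ℤ → Hom ℤ.+-0-abelianGroup ℤ.+-0-abelianGroup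
mulBy m = record
  { ⟦_⟧ = m *_
  ; isGroupHomomorphism = record
    { isMonoidHomomorphism = record
      { isMagmaHomomorphism = record
        { isRelHomomorphism = record { cong = cong (m *_) }
        ; homo = ℤ.*-distribˡ-+ m
        }
      ; ε-homo = ℤ.*-zeroʳ m
      }
    ; ⁻¹-homo = λ x → sym (ℤ.neg-distribʳ-* m x)
    }
  }

-- ℤ / mℤ

𝐙 : ℕ → AbelianGroup 0ℓ 0ℓ
𝐙 m = cokernel ℤ.+-0-abelianGroup ℤ.+-0-abelianGroup (mulBy (+ m))

------------------------------------------------------------------------
-- Finite simple graphs and their critical groups

-- `vertices` lists every vertex exactly once, so degrees and sums over V can be
-- computed along it.

record FiniteGraph : Set₁ where
  infix 4 _~_ _~?_ _≟_
  field
    V        : Set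
    vertices : List V
    complete : ∀ v → v ∈ vertices
    unique   : Unique vertices
    _≟_      : DecidableEquality V
    _~_      : Rel V 0ℓ
    _~?_     : Decidable _~_
    ~-sym    : Symmetric _~_
    ~-irrefl : Irreflexive _≡_ _~_

module _ {A : Set} where

  ∑ : List A → (A → ℤ) → ℤ
  ∑ xs f = foldr (λ x s → f x + s) 0ℤ xs

  ∑-cong : ∀ xs {f g : A → ℤ} → (∀ x → f x ≡ g x) → ∑ xs f ≡ ∑ xs g
  ∑-cong []       f≗g = refl
  ∑-cong (x ∷ xs) f≗g = cong₂ _+_ (f≗g x) (∑-cong xs f≗g)

  ∑-zero : ∀ xs → ∑ xs (λ _ → 0ℤ) ≡ 0ℤ
  ∑-zero []       = refl
  ∑-zero (x ∷ xs) = trans (ℤ.+-identityˡ _) (∑-zero xs)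

  ∑-+ : ∀ xs (f g : A → ℤ) → ∑ xs (λ x → f x + g x) ≡ ∑ xs f + ∑ xs g
  ∑-+ []       f g = refl
  ∑-+ (x ∷ xs) f g = trans (cong (_+_ (f x + g x)) (∑-+ xs f g))
    (interchange (f x) (g x) (∑ xs f) (∑ xs g))
    where open CommutativeSemigroupProperties ℤ.+-commutativeSemigroup using (interchange)

  ∑-neg : ∀ xs (f : A → ℤ) → ∑ xs (λ x → - f x) ≡ - ∑ xs f
  ∑-neg []       f = refl
  ∑-neg (x ∷ xs) f = trans (cong (_+_ (- f x)) (∑-neg xs f))
    (sym (ℤ.neg-distrib-+ (f x) (∑ xs f)))

module _ (Γ : FiniteGraph) where

  open FiniteGraph Γ

  degree : V → ℕ
  degree v = length (filter (v ~?_) vertices)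

  adjacencyMatrix : V → V → ℤ
  adjacencyMatrix v w = if ⌊ v ~? w ⌋ then 1ℤ else 0ℤ

  degreeMatrix : V → V → ℤ
  degreeMatrix v w = if ⌊ v ≟ w ⌋ then + degree v else 0ℤ

  laplacianMatrix : V → V → ℤ
  laplacianMatrix v w = degreeMatrix v w - adjacencyMatrix v w

  ℤ^V : AbelianGroup 0ℓ 0ℓ
  ℤ^V = Pointwise.abelianGroup V ℤ.+-0-abelianGroup

  laplacian : Hom ℤ^V ℤ^V
  laplacian = record
    { ⟦_⟧ = λ x v → ∑ vertices (λ w → L v w * x w)
    ; isGroupHomomorphism = record
      { isMonoidHomomorphism = record
        { isMagmaHomomorphism = record
          { isRelHomomorphism = record
            { cong = λ x≗y v → ∑-cong vertices (λ w → cong (L v w *_) (x≗y w)) }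
          ; homo = λ x y v → trans
              (∑-cong vertices (λ w → ℤ.*-distribˡ-+ (L v w) (x w) (y w)))
              (∑-+ vertices (λ w → L v w * x w) (λ w → L v w * y w))
          }
        ; ε-homo = λ v → trans
            (∑-cong vertices (λ w → ℤ.*-zeroʳ (L v w)))
            (∑-zero vertices)
        }
      ; ⁻¹-homo = λ x v → trans
          (∑-cong vertices (λ w → sym (ℤ.neg-distribʳ-* (L v w) (x w))))
          (∑-neg vertices (λ w → L v w * x w))
      }
    }
    where
    L : V → V → ℤ
    L = laplacianMatrix

  criticalGroup : AbelianGroup 0ℓ 0ℓ
  criticalGroup = torsionSubgroup (cokernel ℤ^V ℤ^V laplacian)

------------------------------------------------------------------------
-- Kneser graphs

KSubset : ℕ → ℕ → Set
KSubset n k = Σ[ p ∈ Subset n ] ∣ p ∣ ≡ k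

module _ {n k : ℕ} where

  KSubset-≡ : {p q : KSubset n k} → proj₁ p ≡ proj₁ q → p ≡ q
  KSubset-≡ {p , e} {.p , e′} refl = cong (p ,_) (ℕ.≡-irrelevant e e′)

  infix 4 _≟ˢ_

  _≟ˢ_ : DecidableEquality (KSubset n k)
  p ≟ˢ q = map′ KSubset-≡ (cong proj₁) (≡-dec Bool._≟_ (proj₁ p) (proj₁ q))

  Disjoint : Rel (KSubset n k) 0ℓ
  Disjoint p q = Empty (proj₁ p ∩ proj₁ q)

  disjoint? : Decidable Disjoint
  disjoint? p q = ¬? (nonempty? (proj₁ p ∩ proj₁ q))

  Disjoint-sym : Symmetric Disjoint
  Disjoint-sym {p} {q} = subst Empty (∩-comm (proj₁ p) (proj₁ q))

  Disjoint-irrefl : .{{NonZero k}} → Irreflexive _≡_ Disjoint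
  Disjoint-irrefl {p , ∣p∣≡k} refl p∩p-empty = ℕ.≢-nonZero⁻¹ k (begin
    k          ≡⟨ ∣p∣≡k ⟨
    ∣ p ∣      ≡⟨ cong ∣_∣ (Empty-unique {p = p} (subst Empty (∩-idem p) p∩p-empty)) ⟩
    ∣ ⊥ˢ {n} ∣ ≡⟨ ∣⊥∣≡0 n ⟩
    0          ∎)
    where
    open ≡-Reasoning
    open Data.Fin.Subset using () renaming (⊥ to ⊥ˢ)

consIn : ∀ {n k} → KSubset n k → KSubset (suc n) (suc k)
consIn (p , e) = inside ∷ p , cong suc e

consOut : ∀ {n k} → KSubset n k → KSubset (suc n) k
consOut (p , e) = outside ∷ p , e

consIn-injective : ∀ {n k} {p q : KSubset n k} → consIn p ≡ consIn q → p ≡ q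
consIn-injective eq = KSubset-≡ (∷-injectiveʳ (cong proj₁ eq))

consOut-injective : ∀ {n k} {p q : KSubset n k} → consOut p ≡ consOut q → p ≡ q
consOut-injective eq = KSubset-≡ (∷-injectiveʳ (cong proj₁ eq))

kSubsets : ∀ n k → List (KSubset n k)
kSubsets zero    zero    = [ [] , refl ]
kSubsets zero    (suc k) = []
kSubsets (suc n) zero    = map consOut (kSubsets n zero)
kSubsets (suc n) (suc k) = map consIn (kSubsets n k) ++ map consOut (kSubsets n (suc k))

kSubsets-complete : ∀ n k (p : KSubset n k) → p ∈ kSubsets n k
kSubsets-complete zero    zero    ([] , refl) = here refl
kSubsets-complete (suc n) zero    (outside ∷ p , e) =
  ∈-map⁺ consOut (kSubsets-complete n zero (p , e))
kSubsets-complete (suc n) (suc k) (inside ∷ p , refl) =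
  ∈-++⁺ˡ (∈-map⁺ consIn (kSubsets-complete n k (p , refl)))
kSubsets-complete (suc n) (suc k) (outside ∷ p , e) =
  ∈-++⁺ʳ (map consIn (kSubsets n k)) (∈-map⁺ consOut (kSubsets-complete n (suc k) (p , e)))

kSubsets-unique : ∀ n k → Unique (kSubsets n k)
kSubsets-unique zero    zero    = [] ∷ []
kSubsets-unique zero    (suc k) = []
kSubsets-unique (suc n) zero    = map⁺ consOut-injective (kSubsets-unique n zero)
kSubsets-unique (suc n) (suc k) = ++⁺
  (map⁺ consIn-injective (kSubsets-unique n k))
  (map⁺ consOut-injective (kSubsets-unique n (suc k)))
  λ (in₁ , in₂) → consIn≢consOut
    (trans (sym (proj₂ (proj₂ (∈-map⁻ consIn in₁)))) (proj₂ (proj₂ (∈-map⁻ consOut in₂))))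
  where
  consIn≢consOut : ∀ {p q} → consIn {n} {k} p ≢ consOut q
  consIn≢consOut ()

KG : ∀ n k → .{{NonZero k}} → FiniteGraph
KG n k = record
  { V        = KSubset n k
  ; vertices = kSubsets n k
  ; complete = kSubsets-complete n k
  ; unique   = kSubsets-unique n k
  ; _≟_      = _≟ˢ_
  ; _~_      = Disjoint
  ; _~?_     = disjoint?
  ; ~-sym    = λ {p} {q} → Disjoint-sym {x = p} {q}
  ; ~-irrefl = Disjoint-irrefl
  }

{-# OPTIONS --safe #-}

-- Write d for the vector of row sums of x and S for its total.  On KG(n,2) the Laplacian is
-- (Lx)ᵢⱼ = a xᵢⱼ + dᵢ + dⱼ − S with a = (n−1)(n−4)/2, so the row sums of Lx are
-- b dᵢ − (n−3) S with b = n(n−3)/2.  Hence y of total 0 lies in Im L iff there are c, S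
-- and d, with c the entry of d at the point 0, that reproduce the row sums of y and satisfy
-- yᵢⱼ ≡ dᵢ + dⱼ − S mod a.  Eliminating them leaves congruences on
--   gᵢⱼ = yᵢⱼ − y₀ᵢ − y₀ⱼ − σ            modulo a,
--   hᵢ  = Dᵢ − D₀ − b (y₀ᵢ + σ)          modulo a b,
--   q   = D₀ + (n−3) σ                   modulo e = (n−3)(n−4)/2,
-- where D are the row sums of y and σ normalises one of the gᵢⱼ to 0.  Some of these follow
-- from the others; kept are q, the hᵢ with i ∉ {0, 1}, and the gᵢⱼ with i, j ∉ {0, 1} except
-- the normalised one and one more.  So K ≅ 𝐙ₐ^(n(n−5)/2) ⊕ 𝐙ₐ ⊕ 𝐙ₑ ⊕ 𝐙ₐᵦ^(n−2),
-- and 𝐙ₐ ⊕ 𝐙ₑ = 𝐙_(f u) ⊕ 𝐙_(f v) ≅ 𝐙_f ⊕ 𝐙_(f u v) for coprime u and v.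

module Submission where

open import Defs
open import Algebra.Bundles using (AbelianGroup)
open import Algebra.Morphism.Bundles using (GroupHomomorphism)
import Algebra.Properties.AbelianGroup as AbelianGroupProperties
import Algebra.Properties.CommutativeMonoid.Mult as Mult
open import Data.Bool.Base using (if_then_else_)
open import Data.Fin.Base using (Fin; zero; suc; _↑ˡ_; _↑ʳ_; splitAt)
open import Data.Fin.Properties using (splitAt-↑ˡ; splitAt-↑ʳ; join-splitAt)
open import Data.Fin.Subset using (Subset; inside; outside; ⊥; ∣_∣; _∩_; Empty; Nonempty)
open import Data.Fin.Subset.Properties using (nonempty?; ∣⊥∣≡0)
import Data.Integer.Properties as ℤ
open import Data.Integer.Tactic.RingSolver using (solve-∀)
open import Data.List.Base using (List; []; _∷_; map; _++_; filter; length)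
open import Data.List.Membership.Propositional using (_∈_)
open import Data.List.Relation.Unary.All as All using (All; []; _∷_)
open import Data.List.Relation.Unary.AllPairs using ([]; _∷_)
open import Data.List.Relation.Unary.Any using (here; there)
open import Data.List.Relation.Unary.Unique.Propositional using (Unique)
import Data.Nat.Base as ℕ
import Data.Nat.Properties as ℕ
import Data.Nat.Tactic.RingSolver as ℕSolver
open import Data.Nat.Base using (ℕ; zero; suc; NonZero; _/_)
open import Data.Nat.Divisibility using (_∣_; _∤_; divides; ∣m+n∣m⇒∣n; _∣?_; n∣m*n)
open import Data.Nat.DivMod using (m*n/n≡m)
open import Data.Product.Base using (_×_; _,_; proj₁; proj₂; ∃-syntax; Σ-syntax)
open import Data.Sum.Base using (_⊎_; inj₁; inj₂; [_,_]′; map₁)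
open import Data.Vec.Base using ([]; _∷_; here; there)
open import Function.Base using (_∘_; it)
open import Level using (Level; 0ℓ)
open import Relation.Binary.PropositionalEquality
  using (_≡_; _≢_; refl; sym; trans; cong; cong₂; subst; _≗_; module ≡-Reasoning)
open import Relation.Nullary using (yes; no; contradiction)
open import Relation.Nullary.Decidable using (⌊_⌋; from-no)
open import Relation.Unary using (Pred; Decidable)

-- A module of its own, since the theorem reads the arithmetic symbols in ℕ.

module KneserLaplacian where

  open import Data.Integer.Base using (ℤ; +_; 0ℤ; 1ℤ; -1ℤ; _+_; _-_; _*_; -_)
  open import Algebra.Properties.AbelianGroup ℤ.+-0-abelianGroup using () renaming (∙-cancelʳ to +-cancelʳ)
  open import Algebra.Properties.Semiring.Sum ℤ.+-*-semiring using (sum; sum-cong-≗; ∑-distrib-+)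
  open ≡-Reasoning

  -- Integer identities and linear functionals

  -- Adding a multiple of a hypothesis to an equation of integers leaves a ring identity.

  by-adding : ∀ {p q} k → p ≡ q → ∀ {u v} → u + k * q ≡ v + k * p → u ≡ v
  by-adding {p} k refl {u} {v} = +-cancelʳ (k * p) u v

  -- `congruent` is a field because pointwise equal functions need not be propositionally equal.
  record Linear {I : Set} (F : (I → ℤ) → ℤ) : Set where
    field
      congruent : ∀ {x y} → x ≗ y → F x ≡ F y
      additive  : ∀ x y → F (λ i → x i + y i) ≡ F x + F y
      homogeneous : ∀ k x → F (λ i → k * x i) ≡ k * F x

    subtractive : ∀ x y → F (λ i → x i - y i) ≡ F x - F y
    subtractive x y = begin
      F (λ i → x i - y i)            ≡⟨ congruent (λ i → cong (_+_ (x i)) (sym (ℤ.-1*i≡-i (y i)))) ⟩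
      F (λ i → x i + -1ℤ * y i)      ≡⟨ additive x _ ⟩
      F x + F (λ i → -1ℤ * y i)      ≡⟨ cong (_+_ (F x)) (homogeneous -1ℤ y) ⟩
      F x + -1ℤ * F y                ≡⟨ cong (_+_ (F x)) (ℤ.-1*i≡-i (F y)) ⟩
      F x - F y                      ∎

  open Linear

  module _ {I : Set} where

    eval-linear : (i : I) → Linear (λ x → x i)
    eval-linear i = record
      { congruent = λ x≗y → x≗y i ; additive = λ _ _ → refl ; homogeneous = λ _ _ → refl }

    zero-linear : Linear {I} (λ _ → 0ℤ)
    zero-linear = record
      { congruent = λ _ → refl ; additive = λ _ _ → refl ; homogeneous = λ k _ → sym (ℤ.*-zeroʳ k) }

    ∘-linear : {J : Set} {F : (J → ℤ) → ℤ} (h : J → I) → Linear F → Linear (λ x → F (x ∘ h))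
    ∘-linear h l = record
      { congruent = λ x≗y → congruent l (x≗y ∘ h)
      ; additive = λ x y → additive l (x ∘ h) (y ∘ h)
      ; homogeneous = λ k x → homogeneous l k (x ∘ h) }

    module _ {F G : (I → ℤ) → ℤ} (f : Linear F) (g : Linear G) where

      +-linear : Linear (λ x → F x + G x)
      +-linear = record
        { congruent = λ x≗y → cong₂ _+_ (congruent f x≗y) (congruent g x≗y)
        ; additive = λ x y → trans (cong₂ _+_ (additive f x y) (additive g x y)) (swap (F x) (F y) (G x) (G y))
        ; homogeneous = λ k x → trans (cong₂ _+_ (homogeneous f k x) (homogeneous g k x))
            (sym (ℤ.*-distribˡ-+ k (F x) (G x))) }
        where
        swap : ∀ a b c d → (a + b) + (c + d) ≡ (a + c) + (b + d)
        swap = solve-∀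

      minus-linear : Linear (λ x → F x - G x)
      minus-linear = record
        { congruent = λ x≗y → cong₂ _-_ (congruent f x≗y) (congruent g x≗y)
        ; additive = λ x y → trans (cong₂ _-_ (additive f x y) (additive g x y)) (swap (F x) (F y) (G x) (G y))
        ; homogeneous = λ k x → trans (cong₂ _-_ (homogeneous f k x) (homogeneous g k x))
            (factor k (F x) (G x)) }
        where
        swap : ∀ a b c d → (a + b) - (c + d) ≡ (a - c) + (b - d)
        swap = solve-∀
        factor : ∀ k a b → k * a - k * b ≡ k * (a - b)
        factor = solve-∀

    scale-linear : ∀ c {F : (I → ℤ) → ℤ} → Linear F → Linear (λ x → c * F x)
    scale-linear c {F} f = record
      { congruent = λ x≗y → cong (c *_) (congruent f x≗y)
      ; additive = λ x y → trans (cong (c *_) (additive f x y)) (ℤ.*-distribˡ-+ c (F x) (F y))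
      ; homogeneous = λ k x → trans (cong (c *_) (homogeneous f k x)) (swap c k (F x)) }
      where
      swap : ∀ c k a → c * (k * a) ≡ k * (c * a)
      swap = solve-∀

    sum-linear : ∀ {n} {F : Fin n → (I → ℤ) → ℤ} → (∀ i → Linear (F i)) → Linear (λ x → sum (λ i → F i x))
    sum-linear {zero}  f = zero-linear
    sum-linear {suc n} f = +-linear (f zero) (sum-linear (f ∘ suc))

  sum-isLinear : ∀ {n} → Linear (sum {n})
  sum-isLinear = sum-linear eval-linear

  sum-const : ∀ n c → sum {n} (λ _ → c) ≡ + n * c
  sum-const zero    c = sym (ℤ.*-zeroˡ c)
  sum-const (suc n) c = begin
    c + sum {n} (λ _ → c)  ≡⟨ cong (_+_ c) (sum-const n c) ⟩
    c + + n * c            ≡⟨ ℤ.suc-* (+ n) c ⟨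
    + suc n * c            ∎

  -- Pairs of points and the incidence matrix

  -- `star i` is the pair {0, i + 1}, and `rest` shifts both endpoints by one.

  data Pair : ℕ → Set where
    star : ∀ {n} → Fin n → Pair (suc n)
    rest : ∀ {n} → Pair n → Pair (suc n)

  total : ∀ {n} → (Pair n → ℤ) → ℤ
  total {zero}  x = 0ℤ
  total {suc n} x = sum (x ∘ star) + total (x ∘ rest)

  -- The incidence matrix of the complete graph and its transpose.

  N : ∀ {n} → (Pair n → ℤ) → Fin n → ℤ
  N x zero    = sum (x ∘ star)
  N x (suc i) = x (star i) + N (x ∘ rest) i

  Nᵀ : ∀ {n} → (Fin n → ℤ) → Pair n → ℤ
  Nᵀ c (star i) = c zero + c (suc i)
  Nᵀ c (rest e) = Nᵀ (c ∘ suc) e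

  total-linear : ∀ {n} → Linear (total {n})
  total-linear {zero}  = zero-linear
  total-linear {suc n} = +-linear (∘-linear star sum-isLinear) (∘-linear rest total-linear)

  N-linear : ∀ {n} (i : Fin n) → Linear (λ x → N x i)
  N-linear zero    = ∘-linear star sum-isLinear
  N-linear (suc i) = +-linear (eval-linear (star i)) (∘-linear rest (N-linear i))

  Nᵀ-linear : ∀ {n} (e : Pair n) → Linear (λ c → Nᵀ c e)
  Nᵀ-linear (star i) = +-linear (eval-linear zero) (eval-linear (suc i))
  Nᵀ-linear (rest e) = ∘-linear suc (Nᵀ-linear e)

  handshake : ∀ {n} (x : Pair n → ℤ) → sum (N x) ≡ + 2 * total x
  handshake {zero}  x = refl
  handshake {suc n} x = begin
    σ + sum (λ i → x (star i) + N (x ∘ rest) i)  ≡⟨ cong (_+_ σ) (∑-distrib-+ (x ∘ star) (N (x ∘ rest))) ⟩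
    σ + (σ + sum (N (x ∘ rest)))                 ≡⟨ cong (λ s → σ + (σ + s)) (handshake (x ∘ rest)) ⟩
    σ + (σ + + 2 * total (x ∘ rest))             ≡⟨ double σ (total (x ∘ rest)) ⟩
    + 2 * (σ + total (x ∘ rest))                 ∎
    where
    σ : ℤ
    σ = sum (x ∘ star)
    double : ∀ s t → s + (s + + 2 * t) ≡ + 2 * (s + t)
    double = solve-∀

  N-const : ∀ {n} c (i : Fin n) → N (λ _ → c) i ≡ (+ n - 1ℤ) * c
  N-const {suc n} c zero    = trans (sum-const n c) (shift (+ n) c)
    where
    shift : ∀ n c → n * c ≡ (1ℤ + n - 1ℤ) * c
    shift = solve-∀
  N-const {suc n} c (suc i) = trans (cong (_+_ c) (N-const c i)) (shift (+ n) c)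
    where
    shift : ∀ n c → c + (n - 1ℤ) * c ≡ (1ℤ + n - 1ℤ) * c
    shift = solve-∀

  -- In matrix form `N Nᵀ = (n - 2) I + J`: of the n - 1 copies of `c i` collected at the point `i`,
  -- one is absorbed into `sum c`.
  N-Nᵀ : ∀ {n} c (i : Fin n) → N (Nᵀ c) i ≡ (+ n - + 2) * c i + sum c
  N-Nᵀ {suc n} c zero    = begin
    sum (λ i → c zero + c (suc i))                ≡⟨ ∑-distrib-+ (λ (_ : Fin n) → c zero) (c ∘ suc) ⟩
    sum {n} (λ _ → c zero) + sum (c ∘ suc)        ≡⟨ cong (_+ sum (c ∘ suc)) (sum-const n (c zero)) ⟩
    + n * c zero + sum (c ∘ suc)                  ≡⟨ shift (+ n) (c zero) (sum (c ∘ suc)) ⟩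
    (+ suc n - + 2) * c zero + sum c              ∎
    where
    shift : ∀ n c s → n * c + s ≡ (1ℤ + n - + 2) * c + (c + s)
    shift = solve-∀
  N-Nᵀ {suc n} c (suc i) = begin
    c zero + c (suc i) + N (Nᵀ (c ∘ suc)) i                                ≡⟨ cong (_+_ (c zero + c (suc i))) (N-Nᵀ (c ∘ suc) i) ⟩
    c zero + c (suc i) + ((+ n - + 2) * c (suc i) + sum (c ∘ suc))         ≡⟨ shift (+ n) (c zero) (c (suc i)) (sum (c ∘ suc)) ⟩
    (+ suc n - + 2) * c (suc i) + sum c                                    ∎
    where
    shift : ∀ n c d s → c + d + ((n - + 2) * d + s) ≡ (1ℤ + n - + 2) * d + (c + s)
    shift = solve-∀

  -- The Laplacian as an operator on pairs

  -- `Nᵀ N` is 2 I plus the adjacency matrix of the line graph of the complete graph, whose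
  -- complement is the Kneser graph. Hence `Nᵀ N - J = I - A`, and for degree a + 1 the operator is
  -- D - A.
  Λ : ∀ {n} → ℤ → (Pair n → ℤ) → Pair n → ℤ
  Λ a x e = a * x e + (Nᵀ (N x) e - total x)

  Λ-cong : ∀ {n} a {x y : Pair n → ℤ} → x ≗ y → Λ a x ≗ Λ a y
  Λ-cong a x≗y e = cong₂ _+_ (cong (a *_) (x≗y e))
    (cong₂ _-_ (congruent (Nᵀ-linear e) (λ i → congruent (N-linear i) x≗y)) (congruent total-linear x≗y))

  -- By `N-Nᵀ` and `handshake` the term `Nᵀ (N x)` contributes `(n - 2) N x i + 2 total x`, from
  -- which the constant term takes off `(n - 1) total x`. So each row sum of `Λ a x` depends only on
  -- that row sum of `x` and on the total.
  N-Λ : ∀ {n} a (x : Pair n → ℤ) i → N (Λ a x) i ≡ (a + + n - + 2) * N x i - (+ n - + 3) * total x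
  N-Λ {n} a x i = begin
    N (Λ a x) i
      ≡⟨ additive (N-linear i) (λ e → a * x e) _ ⟩
    N (λ e → a * x e) i + N (λ e → Nᵀ (N x) e - total x) i
      ≡⟨ cong₂ _+_ (homogeneous (N-linear i) a x) (subtractive (N-linear i) (Nᵀ (N x)) (λ _ → total x)) ⟩
    a * N x i + (N (Nᵀ (N x)) i - N (λ _ → total x) i)
      ≡⟨ cong₂ (λ s t → a * N x i + (s - t))
           (trans (N-Nᵀ (N x) i) (cong (_+_ ((+ n - + 2) * N x i)) (handshake x)))
           (N-const (total x) i) ⟩
    a * N x i + ((+ n - + 2) * N x i + + 2 * total x - (+ n - 1ℤ) * total x)
      ≡⟨ collect a (+ n) (N x i) (total x) ⟩
    (a + + n - + 2) * N x i - (+ n - + 3) * total x  ∎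
    where
    collect : ∀ a n d s → a * d + ((n - + 2) * d + + 2 * s - (n - 1ℤ) * s)
                          ≡ (a + n - + 2) * d - (n - + 3) * s
    collect = solve-∀

  -- Summing `N-Λ` over all points gives twice the total as `(2 b - n (n - 3)) total x`, and the
  -- hypothesis on `a` says exactly 2 b = n (n - 3).
  total-Λ : ∀ {n} a → + 2 * a ≡ (+ n - 1ℤ) * (+ n - + 4) → (x : Pair n → ℤ) → total (Λ a x) ≡ 0ℤ
  total-Λ {n} a ha x = ℤ.*-cancelˡ-≡ (+ 2) (total (Λ a x)) 0ℤ (begin
    + 2 * total (Λ a x)
      ≡⟨ handshake (Λ a x) ⟨
    sum (N (Λ a x))
      ≡⟨ sum-cong-≗ (N-Λ a x) ⟩
    sum (λ i → b * N x i - (+ n - + 3) * total x)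
      ≡⟨ subtractive sum-isLinear (λ i → b * N x i) (λ _ → (+ n - + 3) * total x) ⟩
    sum (λ i → b * N x i) - sum {n} (λ _ → (+ n - + 3) * total x)
      ≡⟨ cong₂ _-_ (homogeneous sum-isLinear b (N x)) (sum-const n _) ⟩
    b * sum (N x) - + n * ((+ n - + 3) * total x)
      ≡⟨ cong (λ s → b * s - + n * ((+ n - + 3) * total x)) (handshake x) ⟩
    b * (+ 2 * total x) - + n * ((+ n - + 3) * total x)
      ≡⟨ by-adding (total x) ha (collect a (+ n) (total x)) ⟩
    0ℤ  ∎)
    where
    b : ℤ
    b = a + + n - + 2
    collect : ∀ a n s → (a + n - + 2) * (+ 2 * s) - n * ((n - + 3) * s) + s * ((n - 1ℤ) * (n - + 4))
                        ≡ 0ℤ + s * (+ 2 * a)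
    collect = solve-∀

  -- Sums over lists and the Laplacian of a finite graph

  module _ {A : Set} where

    ∑-++ : ∀ xs ys (f : A → ℤ) → ∑ (xs ++ ys) f ≡ ∑ xs f + ∑ ys f
    ∑-++ []       ys f = sym (ℤ.+-identityˡ _)
    ∑-++ (x ∷ xs) ys f = trans (cong (_+_ (f x)) (∑-++ xs ys f)) (sym (ℤ.+-assoc (f x) _ _))

    ∑-map : ∀ {B : Set} (h : A → B) xs (f : B → ℤ) → ∑ (map h xs) f ≡ ∑ xs (f ∘ h)
    ∑-map h []       f = refl
    ∑-map h (x ∷ xs) f = cong (_+_ (f (h x))) (∑-map h xs f)

    length-filter : ∀ {P : Pred A 0ℓ} (P? : Decidable P) xs →
                    + length (filter P? xs) ≡ ∑ xs (λ x → if ⌊ P? x ⌋ then 1ℤ else 0ℤ)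
    length-filter P? []       = refl
    length-filter P? (x ∷ xs) with P? x
    ... | yes _ = cong (_+_ 1ℤ) (length-filter P? xs)
    ... | no  _ = trans (length-filter P? xs) (sym (ℤ.+-identityˡ _))

  module _ (Γ : FiniteGraph) where

    open FiniteGraph Γ

    ∑-diagonal-∉ : ∀ v c (x : V → ℤ) {ws} → All (v ≢_) ws →
                   ∑ ws (λ w → (if ⌊ v ≟ w ⌋ then c else 0ℤ) * x w) ≡ 0ℤ
    ∑-diagonal-∉ v c x []           = refl
    ∑-diagonal-∉ v c x (_∷_ {w} v≢w v∉ws) with v ≟ w
    ... | yes v≡w = contradiction v≡w v≢w
    ... | no  _   = trans (ℤ.+-identityˡ _) (∑-diagonal-∉ v c x v∉ws)

    ∑-diagonal : ∀ v c (x : V → ℤ) {ws} → Unique ws → v ∈ ws →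
                 ∑ ws (λ w → (if ⌊ v ≟ w ⌋ then c else 0ℤ) * x w) ≡ c * x v
    ∑-diagonal v c x (v∉ws ∷ _) (here refl) with v ≟ v
    ... | yes _  = trans (cong (_+_ (c * x v)) (∑-diagonal-∉ v c x v∉ws)) (ℤ.+-identityʳ _)
    ... | no v≢v = contradiction refl v≢v
    ∑-diagonal v c x (_∷_ {w} w∉ws ws!) (there v∈ws) with v ≟ w
    ... | yes refl = contradiction refl (All.lookup w∉ws v∈ws)
    ... | no _     = trans (ℤ.+-identityˡ _) (∑-diagonal v c x ws! v∈ws)

    -- The diagonal sum collapses because `vertices` lists `v` exactly once. The degree is rewritten
    -- as a row sum of the adjacency matrix, so that one formula for adjacency sums later serves
    -- both terms.
    laplacian-apply : ∀ x v → GroupHomomorphism.⟦_⟧ (laplacian Γ) x v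
                      ≡ ∑ vertices (adjacencyMatrix Γ v) * x v - ∑ vertices (λ w → adjacencyMatrix Γ v w * x w)
    laplacian-apply x v = begin
      ∑ vertices (λ w → (D w - A w) * x w)
        ≡⟨ ∑-cong vertices (λ w → distrib (D w) (A w) (x w)) ⟩
      ∑ vertices (λ w → D w * x w + - (A w * x w))
        ≡⟨ ∑-+ vertices (λ w → D w * x w) _ ⟩
      ∑ vertices (λ w → D w * x w) + ∑ vertices (λ w → - (A w * x w))
        ≡⟨ cong₂ _+_ (∑-diagonal v _ x unique (complete v)) (∑-neg vertices (λ w → A w * x w)) ⟩
      + degree Γ v * x v - ∑ vertices (λ w → A w * x w)
        ≡⟨ cong (λ d → d * x v - ∑ vertices (λ w → A w * x w)) (length-filter (v ~?_) vertices) ⟩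
      ∑ vertices A * x v - ∑ vertices (λ w → A w * x w)
        ∎
      where
      D A : V → ℤ
      D = degreeMatrix Γ v
      A = adjacencyMatrix Γ v
      distrib : ∀ d a y → (d - a) * y ≡ d * y + - (a * y)
      distrib = solve-∀

  -- Disjointness, and two-element subsets as pairs

  -- An arithmetic form of disjointness that follows the recursion of `kSubsets`.

  disjointness : ∀ {n} → Subset n → Subset n → ℤ
  disjointness []            []            = 1ℤ
  disjointness (inside  ∷ p) (inside  ∷ q) = 0ℤ
  disjointness (inside  ∷ p) (outside ∷ q) = disjointness p q
  disjointness (outside ∷ p) (_       ∷ q) = disjointness p q

  disjointness-Nonempty : ∀ {n} (p q : Subset n) → Nonempty (p ∩ q) → disjointness p q ≡ 0ℤ
  disjointness-Nonempty (inside  ∷ p) (inside  ∷ q) _                  = refl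
  disjointness-Nonempty (inside  ∷ p) (outside ∷ q) (suc i , there i∈) = disjointness-Nonempty p q (i , i∈)
  disjointness-Nonempty (outside ∷ p) (_       ∷ q) (suc i , there i∈) = disjointness-Nonempty p q (i , i∈)

  disjointness-Empty : ∀ {n} (p q : Subset n) → Empty (p ∩ q) → disjointness p q ≡ 1ℤ
  disjointness-Empty []            []            _     = refl
  disjointness-Empty (inside  ∷ p) (inside  ∷ q) empty = contradiction (zero , here) empty
  disjointness-Empty (inside  ∷ p) (outside ∷ q) empty =
    disjointness-Empty p q λ (i , i∈) → empty (suc i , there i∈)
  disjointness-Empty (outside ∷ p) (_       ∷ q) empty =
    disjointness-Empty p q λ (i , i∈) → empty (suc i , there i∈)

  adjacency-KG : ∀ {n} (v w : KSubset n 2) →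
                 adjacencyMatrix (KG n 2) v w ≡ disjointness (proj₁ v) (proj₁ w)
  adjacency-KG (p , _) (q , _) with nonempty? (p ∩ q)
  ... | yes nonempty = sym (disjointness-Nonempty p q nonempty)
  ... | no  empty    = sym (disjointness-Empty p q empty)

  disjointness-⊥ˡ : ∀ {n} (q : Subset n) → disjointness ⊥ q ≡ 1ℤ
  disjointness-⊥ˡ []      = refl
  disjointness-⊥ˡ (_ ∷ q) = disjointness-⊥ˡ q

  disjointness-⊥ʳ : ∀ {n} (p : Subset n) → disjointness p ⊥ ≡ 1ℤ
  disjointness-⊥ʳ []            = refl
  disjointness-⊥ʳ (inside  ∷ p) = disjointness-⊥ʳ p
  disjointness-⊥ʳ (outside ∷ p) = disjointness-⊥ʳ p

  ∅ : ∀ n → KSubset n 0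
  ∅ n = ⊥ , ∣⊥∣≡0 n

  singleton : ∀ {n} → Fin n → KSubset n 1
  singleton zero    = consIn (∅ _)
  singleton (suc i) = consOut (singleton i)

  toSubset : ∀ {n} → Pair n → KSubset n 2
  toSubset (star i) = consIn (singleton i)
  toSubset (rest e) = consOut (toSubset e)

  element : ∀ {n} → KSubset n 1 → Fin n
  element (inside  ∷ p , e) = zero
  element (outside ∷ p , e) = suc (element (p , e))

  fromSubset : ∀ {n} → KSubset n 2 → Pair n
  fromSubset (inside  ∷ p , e) = star (element (p , ℕ.suc-injective e))
  fromSubset (outside ∷ p , e) = rest (fromSubset (p , e))

  -- The cardinality proof `e` is arbitrary because `fromSubset` supplies one rebuilt with
  -- `suc-injective`, not the one stored in `singleton i`.
  element-singleton : ∀ {n} (i : Fin n) e → element (proj₁ (singleton i) , e) ≡ i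
  element-singleton zero    e = refl
  element-singleton (suc i) e = cong suc (element-singleton i e)

  fromSubset-toSubset : ∀ {n} (e : Pair n) → fromSubset (toSubset e) ≡ e
  fromSubset-toSubset (star i) = cong star (element-singleton i _)
  fromSubset-toSubset (rest e) = cong rest (fromSubset-toSubset e)

  ∣p∣≡0⇒⊥≡p : ∀ {n} (p : Subset n) → ∣ p ∣ ≡ 0 → ⊥ ≡ p
  ∣p∣≡0⇒⊥≡p []            _ = refl
  ∣p∣≡0⇒⊥≡p (outside ∷ p) e = cong (outside ∷_) (∣p∣≡0⇒⊥≡p p e)

  singleton-element : ∀ {n} (v : KSubset n 1) → proj₁ (singleton (element v)) ≡ proj₁ v
  singleton-element (inside  ∷ p , e) = cong (inside ∷_) (∣p∣≡0⇒⊥≡p p (ℕ.suc-injective e))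
  singleton-element (outside ∷ p , e) = cong (outside ∷_) (singleton-element (p , e))

  toSubset-fromSubset : ∀ {n} (v : KSubset n 2) → toSubset (fromSubset v) ≡ v
  toSubset-fromSubset v = KSubset-≡ (go v)
    where
    go : ∀ {n} (v : KSubset n 2) → proj₁ (toSubset (fromSubset v)) ≡ proj₁ v
    go (inside  ∷ p , e) = cong (inside ∷_) (singleton-element (p , ℕ.suc-injective e))
    go (outside ∷ p , e) = cong (outside ∷_) (go (p , e))

  -- Sums over subsets of size at most two

  ∑-0-subsets : ∀ n f → ∑ (kSubsets n 0) f ≡ f (∅ n)
  ∑-0-subsets zero    f = ℤ.+-identityʳ _
  ∑-0-subsets (suc n) f = trans (∑-map consOut (kSubsets n 0) f) (∑-0-subsets n (f ∘ consOut))

  ∑-1-subsets : ∀ n f → ∑ (kSubsets n 1) f ≡ sum (f ∘ singleton)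
  ∑-1-subsets zero    f = refl
  ∑-1-subsets (suc n) f = begin
    ∑ (map consIn (kSubsets n 0) ++ map consOut (kSubsets n 1)) f      ≡⟨ ∑-++ (map consIn (kSubsets n 0)) _ f ⟩
    ∑ (map consIn (kSubsets n 0)) f + ∑ (map consOut (kSubsets n 1)) f ≡⟨ cong₂ _+_ (∑-map consIn (kSubsets n 0) f) (∑-map consOut (kSubsets n 1) f) ⟩
    ∑ (kSubsets n 0) (f ∘ consIn) + ∑ (kSubsets n 1) (f ∘ consOut)     ≡⟨ cong₂ _+_ (∑-0-subsets n (f ∘ consIn)) (∑-1-subsets n (f ∘ consOut)) ⟩
    sum (f ∘ singleton)                                                ∎

  -- `kSubsets` splits by whether the first point belongs to the subset, which is the split into
  -- `star` and `rest`.
  ∑-2-subsets : ∀ n f → ∑ (kSubsets n 2) f ≡ total (f ∘ toSubset)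
  ∑-2-subsets zero    f = refl
  ∑-2-subsets (suc n) f = begin
    ∑ (map consIn (kSubsets n 1) ++ map consOut (kSubsets n 2)) f      ≡⟨ ∑-++ (map consIn (kSubsets n 1)) _ f ⟩
    ∑ (map consIn (kSubsets n 1)) f + ∑ (map consOut (kSubsets n 2)) f ≡⟨ cong₂ _+_ (∑-map consIn (kSubsets n 1) f) (∑-map consOut (kSubsets n 2) f) ⟩
    ∑ (kSubsets n 1) (f ∘ consIn) + ∑ (kSubsets n 2) (f ∘ consOut)     ≡⟨ cong₂ _+_ (∑-1-subsets n (f ∘ consIn)) (∑-2-subsets n (f ∘ consOut)) ⟩
    total (f ∘ toSubset)                                               ∎

  -- The Laplacian of the Kneser graph

  sum-0* : ∀ {n} (x : Fin n → ℤ) → sum (λ i → 0ℤ * x i) ≡ 0ℤ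
  sum-0* x = homogeneous sum-isLinear 0ℤ x

  sum-disjoint-singletons : ∀ {n} (i : Fin n) x →
    sum (λ j → disjointness (proj₁ (singleton i)) (proj₁ (singleton j)) * x j) ≡ sum x - x i
  sum-disjoint-singletons {suc n} zero    x = begin
    0ℤ * x zero + sum (λ j → disjointness ⊥ (proj₁ (singleton j)) * x (suc j))
      ≡⟨ cong (_+_ (0ℤ * x zero)) (sum-cong-≗ λ j → cong (_* x (suc j)) (disjointness-⊥ˡ (proj₁ (singleton j)))) ⟩
    0ℤ * x zero + sum (λ j → 1ℤ * x (suc j))
      ≡⟨ cong (_+_ (0ℤ * x zero)) (sum-cong-≗ λ j → ℤ.*-identityˡ (x (suc j))) ⟩
    0ℤ * x zero + sum (x ∘ suc)
      ≡⟨ drop (x zero) _ ⟩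
    sum x - x zero  ∎
    where
    drop : ∀ a s → 0ℤ * a + s ≡ a + s - a
    drop = solve-∀
  sum-disjoint-singletons {suc n} (suc i) x = begin
    disjointness (proj₁ (singleton i)) ⊥ * x zero + _
      ≡⟨ cong₂ (λ d s → d * x zero + s) (disjointness-⊥ʳ (proj₁ (singleton i))) (sum-disjoint-singletons i (x ∘ suc)) ⟩
    1ℤ * x zero + (sum (x ∘ suc) - x (suc i))
      ≡⟨ regroup (x zero) _ _ ⟩
    sum x - x (suc i)  ∎
    where
    regroup : ∀ a s t → 1ℤ * a + (s - t) ≡ a + s - t
    regroup = solve-∀

  sum-disjoint-pair : ∀ {n} (e : Pair n) x →
    sum (λ j → disjointness (proj₁ (toSubset e)) (proj₁ (singleton j)) * x j) ≡ sum x - Nᵀ x e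
  sum-disjoint-pair (star i) x = trans
    (cong (_+_ (0ℤ * x zero)) (sum-disjoint-singletons i (x ∘ suc)))
    (regroup (x zero) (sum (x ∘ suc)) (x (suc i)))
    where
    regroup : ∀ a s t → 0ℤ * a + (s - t) ≡ a + s - (a + t)
    regroup = solve-∀
  sum-disjoint-pair (rest e) x = begin
    disjointness (proj₁ (toSubset e)) ⊥ * x zero + _
      ≡⟨ cong₂ (λ d s → d * x zero + s) (disjointness-⊥ʳ (proj₁ (toSubset e))) (sum-disjoint-pair e (x ∘ suc)) ⟩
    1ℤ * x zero + (sum (x ∘ suc) - Nᵀ (x ∘ suc) e)
      ≡⟨ regroup (x zero) _ _ ⟩
    sum x - Nᵀ x (rest e)  ∎
    where
    regroup : ∀ a s t → 1ℤ * a + (s - t) ≡ a + s - t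
    regroup = solve-∀

  total-disjoint-singleton : ∀ {n} (i : Fin n) x →
    total (λ e → disjointness (proj₁ (singleton i)) (proj₁ (toSubset e)) * x e) ≡ total x - N x i
  total-disjoint-singleton {suc n} zero    x = begin
    sum (λ j → 0ℤ * x (star j)) + total (λ e → disjointness ⊥ (proj₁ (toSubset e)) * x (rest e))
      ≡⟨ cong₂ _+_ (sum-0* (x ∘ star)) (congruent total-linear λ e →
           trans (cong (_* x (rest e)) (disjointness-⊥ˡ (proj₁ (toSubset e)))) (ℤ.*-identityˡ (x (rest e)))) ⟩
    0ℤ + total (x ∘ rest)
      ≡⟨ drop (sum (x ∘ star)) _ ⟩
    total x - N x zero  ∎
    where
    drop : ∀ a s → 0ℤ + s ≡ a + s - a
    drop = solve-∀
  total-disjoint-singleton {suc n} (suc i) x = trans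
    (cong₂ _+_ (sum-disjoint-singletons i (x ∘ star)) (total-disjoint-singleton i (x ∘ rest)))
    (regroup (sum (x ∘ star)) (x (star i)) (total (x ∘ rest)) (N (x ∘ rest) i))
    where
    regroup : ∀ s a t b → s - a + (t - b) ≡ s + t - (a + b)
    regroup = solve-∀

  -- Inclusion and exclusion: taking off the row sums at both endpoints of `e` removes every pair
  -- that meets `e`, but `e` itself twice, so `x e` is added back.
  total-disjoint-pair : ∀ {n} (e : Pair n) x →
    total (λ e′ → disjointness (proj₁ (toSubset e)) (proj₁ (toSubset e′)) * x e′) ≡ total x - Nᵀ (N x) e + x e
  total-disjoint-pair (star i) x = trans
    (cong₂ _+_ (sum-0* (x ∘ star)) (total-disjoint-singleton i (x ∘ rest)))
    (regroup (sum (x ∘ star)) (total (x ∘ rest)) (N (x ∘ rest) i) (x (star i)))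
    where
    regroup : ∀ s t b a → 0ℤ + (t - b) ≡ s + t - (s + (a + b)) + a
    regroup = solve-∀
  total-disjoint-pair (rest e) x = trans
    (cong₂ _+_ (sum-disjoint-pair e (x ∘ star)) (total-disjoint-pair e (x ∘ rest))) (begin
    sum (x ∘ star) - Nᵀ (x ∘ star) e + (total (x ∘ rest) - Nᵀ (N (x ∘ rest)) e + x (rest e))
      ≡⟨ regroup (sum (x ∘ star)) (Nᵀ (x ∘ star) e) (total (x ∘ rest)) (Nᵀ (N (x ∘ rest)) e) (x (rest e)) ⟩
    total x - (Nᵀ (x ∘ star) e + Nᵀ (N (x ∘ rest)) e) + x (rest e)
      ≡⟨ cong (λ t → total x - t + x (rest e)) (additive (Nᵀ-linear e) (x ∘ star) (N (x ∘ rest))) ⟨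
    total x - Nᵀ (N x) (rest e) + x (rest e)  ∎)
    where
    regroup : ∀ s a t b c → s - a + (t - b + c) ≡ s + t - (a + b) + c
    regroup = solve-∀

  two-total-1 : ∀ n → + 2 * total {n} (λ _ → 1ℤ) ≡ + n * (+ n - 1ℤ)
  two-total-1 n = begin
    + 2 * total {n} (λ _ → 1ℤ)      ≡⟨ handshake {n} (λ _ → 1ℤ) ⟨
    sum (N {n} (λ _ → 1ℤ))          ≡⟨ sum-cong-≗ (N-const {n} 1ℤ) ⟩
    sum {n} (λ _ → (+ n - 1ℤ) * 1ℤ) ≡⟨ sum-const n _ ⟩
    + n * ((+ n - 1ℤ) * 1ℤ)         ≡⟨ cong (+ n *_) (ℤ.*-identityʳ _) ⟩
    + n * (+ n - 1ℤ)                ∎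

  Nᵀ-const : ∀ {n} c (e : Pair n) → Nᵀ (λ _ → c) e ≡ c + c
  Nᵀ-const c (star i) = refl
  Nᵀ-const c (rest e) = Nᵀ-const c e

  ∑-adjacent : ∀ {n} e (x : KSubset n 2 → ℤ) →
    ∑ (kSubsets n 2) (λ w → adjacencyMatrix (KG n 2) (toSubset e) w * x w)
    ≡ total (x ∘ toSubset) - Nᵀ (N (x ∘ toSubset)) e + x (toSubset e)
  ∑-adjacent {n} e x = begin
    ∑ (kSubsets n 2) (λ w → adjacencyMatrix (KG n 2) (toSubset e) w * x w)
      ≡⟨ ∑-2-subsets n (λ w → adjacencyMatrix (KG n 2) (toSubset e) w * x w) ⟩
    total (λ e′ → adjacencyMatrix (KG n 2) (toSubset e) (toSubset e′) * x (toSubset e′))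
      ≡⟨ congruent total-linear (λ e′ → cong (_* x (toSubset e′)) (adjacency-KG (toSubset e) (toSubset e′))) ⟩
    total (λ e′ → disjointness (proj₁ (toSubset e)) (proj₁ (toSubset e′)) * x (toSubset e′))
      ≡⟨ total-disjoint-pair e (x ∘ toSubset) ⟩
    total (x ∘ toSubset) - Nᵀ (N (x ∘ toSubset)) e + x (toSubset e) ∎

  -- The row sum is the adjacency operator applied to the constant 1. The factor 2 avoids a
  -- division.
  two-degree : ∀ {n} (e : Pair n) →
    + 2 * ∑ (kSubsets n 2) (adjacencyMatrix (KG n 2) (toSubset e)) ≡ (+ n - + 2) * (+ n - + 3)
  two-degree {n} e = begin
    + 2 * ∑ (kSubsets n 2) (adjacencyMatrix (KG n 2) (toSubset e))
      ≡⟨ cong (+ 2 *_) (∑-cong (kSubsets n 2) λ w → ℤ.*-identityʳ (adjacencyMatrix (KG n 2) (toSubset e) w)) ⟨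
    + 2 * ∑ (kSubsets n 2) (λ w → adjacencyMatrix (KG n 2) (toSubset e) w * 1ℤ)
      ≡⟨ cong (+ 2 *_) (∑-adjacent e (λ _ → 1ℤ)) ⟩
    + 2 * (t - Nᵀ (N {n} (λ _ → 1ℤ)) e + 1ℤ)
      ≡⟨ cong (λ s → + 2 * (t - s + 1ℤ)) (trans (congruent (Nᵀ-linear e) (N-const {n} 1ℤ)) (Nᵀ-const ((+ n - 1ℤ) * 1ℤ) e)) ⟩
    + 2 * (t - ((+ n - 1ℤ) * 1ℤ + (+ n - 1ℤ) * 1ℤ) + 1ℤ)
      ≡⟨ by-adding 1ℤ (two-total-1 n) (collect (+ n) t) ⟩
    (+ n - + 2) * (+ n - + 3) ∎
    where
    t : ℤ
    t = total {n} (λ _ → 1ℤ)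
    collect : ∀ n t → + 2 * (t - ((n - 1ℤ) * 1ℤ + (n - 1ℤ) * 1ℤ) + 1ℤ) + 1ℤ * (n * (n - 1ℤ))
                      ≡ (n - + 2) * (n - + 3) + 1ℤ * (+ 2 * t)
    collect = solve-∀

  -- The degree is a + 1, and the surplus 1 cancels against the `x e` of `total-disjoint-pair`.
  laplacian-KG : ∀ {n} a → + 2 * a ≡ (+ n - 1ℤ) * (+ n - + 4) → ∀ x (e : Pair n) →
    GroupHomomorphism.⟦_⟧ (laplacian (KG n 2)) x (toSubset e) ≡ Λ a (x ∘ toSubset) e
  laplacian-KG {n} a ha x e = begin
    GroupHomomorphism.⟦_⟧ (laplacian (KG n 2)) x (toSubset e)
      ≡⟨ laplacian-apply (KG n 2) x (toSubset e) ⟩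
    d * xₑ - ∑ (kSubsets n 2) (λ w → adjacencyMatrix (KG n 2) (toSubset e) w * x w)
      ≡⟨ cong (_-_ (d * xₑ)) (∑-adjacent e x) ⟩
    d * xₑ - (t - s + xₑ)
      ≡⟨ cong (λ d → d * xₑ - (t - s + xₑ)) degree≡ ⟩
    (a + 1ℤ) * xₑ - (t - s + xₑ)
      ≡⟨ collect a xₑ t s ⟩
    Λ a (x ∘ toSubset) e ∎
    where
    d xₑ s t : ℤ
    d  = ∑ (kSubsets n 2) (adjacencyMatrix (KG n 2) (toSubset e))
    xₑ = x (toSubset e)
    s  = Nᵀ (N (x ∘ toSubset)) e
    t  = total (x ∘ toSubset)
    collect : ∀ a x t s → (a + 1ℤ) * x - (t - s + x) ≡ a * x + (s - t)
    collect = solve-∀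
    expand : ∀ a n → (n - + 2) * (n - + 3) + 1ℤ * (+ 2 * a) ≡ + 2 * (a + 1ℤ) + 1ℤ * ((n - 1ℤ) * (n - + 4))
    expand = solve-∀
    degree≡ : d ≡ a + 1ℤ
    degree≡ = ℤ.*-cancelˡ-≡ (+ 2) d (a + 1ℤ)
      (trans (two-degree e) (by-adding 1ℤ (sym ha) (expand a (+ n))))

  -- Splitting off the triangle on the last three points

  -- The pairs of 3 + r points are those of the last three points, the image of
  -- `inner`, and `outerCount r` others.

  outerCount : ℕ → ℕ
  outerCount zero    = 0
  outerCount (suc r) = (3 ℕ.+ r) ℕ.+ outerCount r

  outer : ∀ r → Fin (outerCount r) → Pair (3 ℕ.+ r)
  outer (suc r) i = [ star , rest ∘ outer r ]′ (splitAt (3 ℕ.+ r) i)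

  inner : ∀ r → Pair 3 → Pair (3 ℕ.+ r)
  inner zero    e = e
  inner (suc r) e = rest (inner r e)

  classify : ∀ r → Pair (3 ℕ.+ r) → Fin (outerCount r) ⊎ Pair 3
  classify zero    e        = inj₂ e
  classify (suc r) (star i) = inj₁ (i ↑ˡ outerCount r)
  classify (suc r) (rest e) = map₁ ((3 ℕ.+ r) ↑ʳ_) (classify r e)

  classify-outer : ∀ r i → classify r (outer r i) ≡ inj₁ i
  classify-outer (suc r) i with splitAt (3 ℕ.+ r) i | join-splitAt (3 ℕ.+ r) (outerCount r) i
  ... | inj₁ j | refl = refl
  ... | inj₂ j | refl = cong (map₁ ((3 ℕ.+ r) ↑ʳ_)) (classify-outer r j)

  classify-inner : ∀ r e → classify r (inner r e) ≡ inj₂ e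
  classify-inner zero    e = refl
  classify-inner (suc r) e = cong (map₁ ((3 ℕ.+ r) ↑ʳ_)) (classify-inner r e)

  outer-star : ∀ r i → outer (suc r) (i ↑ˡ outerCount r) ≡ star i
  outer-star r i = cong [ star , rest ∘ outer r ]′ (splitAt-↑ˡ (3 ℕ.+ r) i (outerCount r))

  outer-rest : ∀ r i → outer (suc r) ((3 ℕ.+ r) ↑ʳ i) ≡ rest (outer r i)
  outer-rest r i = cong [ star , rest ∘ outer r ]′ (splitAt-↑ʳ (3 ℕ.+ r) (outerCount r) i)

  cover : ∀ r {P : Pair (3 ℕ.+ r) → Set} → (∀ i → P (outer r i)) → (∀ e → P (inner r e)) → ∀ e → P e
  cover zero    o n e        = n e
  cover (suc r) {P} o n (star i) = subst P (outer-star r i) (o (i ↑ˡ outerCount r))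
  cover (suc r) {P} o n (rest e) =
    cover r {P ∘ rest} (λ i → subst P (outer-rest r i) (o ((3 ℕ.+ r) ↑ʳ i))) n e

  sum-zero : ∀ {n} {x : Fin n → ℤ} → (∀ i → x i ≡ 0ℤ) → sum x ≡ 0ℤ
  sum-zero {n} x≗0 = trans (sum-cong-≗ x≗0) (trans (sum-const n 0ℤ) (ℤ.*-zeroʳ (+ n)))

  total-inner : ∀ r x → (∀ i → x (outer r i) ≡ 0ℤ) → total x ≡ total (x ∘ inner r)
  total-inner zero    x x≗0 = refl
  total-inner (suc r) x x≗0 = begin
    sum (x ∘ star) + total (x ∘ rest)
      ≡⟨ cong₂ _+_
           (sum-zero λ i → trans (cong x (sym (outer-star r i))) (x≗0 (i ↑ˡ outerCount r)))
           (total-inner r (x ∘ rest) λ i → trans (cong x (sym (outer-rest r i))) (x≗0 ((3 ℕ.+ r) ↑ʳ i))) ⟩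
    0ℤ + total (x ∘ rest ∘ inner r)
      ≡⟨ ℤ.+-identityˡ _ ⟩
    total (x ∘ rest ∘ inner r)  ∎

  -- The edges of the last triangle by role: at `base` the invariant `g` is normalised to 0, at
  -- `free` the value is determined by the total, and at `kept` the value of `g` is retained and
  -- later merged with `q`.
  base free kept : ∀ r → Pair (3 ℕ.+ r)
  base r = inner r (star zero)
  free r = inner r (star (suc zero))
  kept r = inner r (rest (star zero))

  cover-triangle : ∀ r {P : Pair (3 ℕ.+ r) → Set} →
    (∀ i → P (outer r i)) → P (base r) → P (free r) → P (kept r) → ∀ e → P e
  cover-triangle r {P} o b f k = cover r {P} o λ
    { (star zero) → b ; (star (suc zero)) → f ; (rest (star zero)) → k ; (rest (rest (rest ()))) }

  triangle : ℤ → ℤ → ℤ → Pair 3 → ℤ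
  triangle b f k (star zero)       = b
  triangle b f k (star (suc zero)) = f
  triangle b f k (rest _)          = k

  extend : ∀ r → (Fin (outerCount r) → ℤ) → (Pair 3 → ℤ) → Pair (3 ℕ.+ r) → ℤ
  extend r t u e = [ t , u ]′ (classify r e)

  extend-outer : ∀ r t u i → extend r t u (outer r i) ≡ t i
  extend-outer r t u i = cong [ t , u ]′ (classify-outer r i)

  extend-inner : ∀ r t u e → extend r t u (inner r e) ≡ u e
  extend-inner r t u e = cong [ t , u ]′ (classify-inner r e)

  -- The two functions differ only at `free r`, so `total-inner` reduces the difference of their
  -- totals to the three edges of the triangle.
  total-extend : ∀ r t b f k → total (extend r t (triangle b f k)) ≡ total (extend r t (triangle b 0ℤ k)) + f
  total-extend r t b f k = by-adding 1ℤ difference (collect (total x) (total y) f)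
    where
    x y : Pair (3 ℕ.+ r) → ℤ
    x = extend r t (triangle b f k)
    y = extend r t (triangle b 0ℤ k)
    at-inner : ∀ e → x (inner r e) - y (inner r e) ≡ triangle b f k e - triangle b 0ℤ k e
    at-inner e = cong₂ _-_ (extend-inner r t _ e) (extend-inner r t _ e)
    at-outer : ∀ i → x (outer r i) - y (outer r i) ≡ 0ℤ
    at-outer i = trans (cong₂ _-_ (extend-outer r t _ i) (extend-outer r t _ i)) (ℤ.+-inverseʳ (t i))
    only-free : ∀ b f k → (b - b + (f - 0ℤ + 0ℤ)) + ((k - k + 0ℤ) + (0ℤ + 0ℤ)) ≡ f
    only-free = solve-∀
    collect : ∀ x y f → x + 1ℤ * f ≡ y + f + 1ℤ * (x - y)
    collect = solve-∀
    difference : total x - total y ≡ f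
    difference = begin
      total x - total y                                               ≡⟨ subtractive total-linear x y ⟨
      total (λ e → x e - y e)                                         ≡⟨ total-inner r (λ e → x e - y e) at-outer ⟩
      total (λ e → x (inner r e) - y (inner r e))                     ≡⟨ congruent total-linear at-inner ⟩
      total (λ e → triangle b f k e - triangle b 0ℤ k e)              ≡⟨ only-free b f k ⟩
      f                                                               ∎

  -- The total depends on the entry at `free r` with coefficient 1, so over the integers that entry
  -- can absorb any prescribed total.
  prescribe : ∀ r (t : Fin (outerCount r) → ℤ) b k s →
    Σ[ z ∈ (Pair (3 ℕ.+ r) → ℤ) ] (∀ i → z (outer r i) ≡ t i) × z (base r) ≡ b × z (kept r) ≡ k × total z ≡ s
  prescribe r t b k s = z
    , extend-outer r t u
    , extend-inner r t u _
    , extend-inner r t u _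
    , trans (total-extend r t b f k) (cancel (total (extend r t (triangle b 0ℤ k))) s)
    where
    f : ℤ
    f = s - total (extend r t (triangle b 0ℤ k))
    u : Pair 3 → ℤ
    u = triangle b f k
    z : Pair (3 ℕ.+ r) → ℤ
    z = extend r t u
    cancel : ∀ x s → x + (s - x) ≡ s
    cancel = solve-∀

  -- The uniqueness counterpart of `prescribe`: once the prescribed entries vanish, the total
  -- determines the remaining one.
  total-free : ∀ r z → (∀ i → z (outer r i) ≡ 0ℤ) → z (base r) ≡ 0ℤ → z (kept r) ≡ 0ℤ → total z ≡ z (free r)
  total-free r z o b k = begin
    total z                                                    ≡⟨ total-inner r z o ⟩
    (z (base r) + (z (free r) + 0ℤ)) + (z (kept r) + 0ℤ + 0ℤ)  ≡⟨ cong₂ (λ b k → (b + (z (free r) + 0ℤ)) + (k + 0ℤ + 0ℤ)) b k ⟩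
    (0ℤ + (z (free r) + 0ℤ)) + 0ℤ                              ≡⟨ drop (z (free r)) ⟩
    z (free r)                                                 ∎
    where
    drop : ∀ f → (0ℤ + (f + 0ℤ)) + 0ℤ ≡ f
    drop = solve-∀

  -- The invariants and their values on the image

  Nᵀ-affine : ∀ {n} k s x y (e : Pair n) → Nᵀ (λ i → k * x i + (y i + s)) e ≡ k * Nᵀ x e + (Nᵀ y e + + 2 * s)
  Nᵀ-affine k s x y (star i) = collect k s (x zero) (x (suc i)) (y zero) (y (suc i))
    where
    collect : ∀ k s a b c d → (k * a + (c + s)) + (k * b + (d + s)) ≡ k * (a + b) + (c + d + + 2 * s)
    collect = solve-∀
  Nᵀ-affine k s x y (rest e) = Nᵀ-affine k s (x ∘ suc) (y ∘ suc) e

  -- The points 0 and 1 play a special role; `Fin M` indexes the others, shifted by two.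

  module _ {M : ℕ} (y : Pair (2 ℕ.+ M) → ℤ) where

    -- This is the entry at {0, p + 2}. The entry at {0, 1} is at `star zero`, and the one at {1, p
    -- + 2} is at `rest (star p)`.
    spoke : Fin M → ℤ
    spoke p = y (star (suc p))

    core : Pair M → ℤ
    core e = y (rest (rest e))

    valency : Fin M → ℤ
    valency p = N y (suc (suc p))

  module Invariants (r : ℕ) (a : ℤ) where

    n : ℕ
    n = 5 ℕ.+ r

    -- When 2 a = (n - 1) (n - 4), these are n - 2, n (n - 3) / 2 and (n - 3) (n - 4) / 2, written
    -- without division.
    m b e : ℤ
    m = + (3 ℕ.+ r)
    b = a + m
    e = a - m + + 2

    module _ (y : Pair n → ℤ) where

      σ : ℤ
      σ = core y (base r) - Nᵀ (spoke y) (base r)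

      g : Pair (3 ℕ.+ r) → ℤ
      g ε = core y ε - Nᵀ (spoke y) ε - σ

      q : ℤ
      q = N y zero + (m - 1ℤ) * σ

      h : Fin (3 ℕ.+ r) → ℤ
      h p = valency y p - N y zero - b * (spoke y p + σ)

    σ-linear : Linear σ
    σ-linear = minus-linear (eval-linear _) (∘-linear (star ∘ suc) (Nᵀ-linear (base r)))

    g-linear : ∀ ε → Linear (λ y → g y ε)
    g-linear ε = minus-linear (minus-linear (eval-linear _) (∘-linear (star ∘ suc) (Nᵀ-linear ε))) σ-linear

    q-linear : Linear q
    q-linear = +-linear (N-linear zero) (scale-linear (m - 1ℤ) σ-linear)

    h-linear : ∀ p → Linear (λ y → h y p)
    h-linear p = minus-linear (minus-linear (N-linear (suc (suc p))) (N-linear zero))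
      (scale-linear b (+-linear (eval-linear _) σ-linear))

    module _ (x : Pair n → ℤ) where

      private
        c S : ℤ
        c = N x zero
        S = total x

      Nᵀ-spoke-Λ : ∀ ε → Nᵀ (spoke (Λ a x)) ε ≡ a * Nᵀ (spoke x) ε + (Nᵀ (valency x) ε + + 2 * (c - S))
      Nᵀ-spoke-Λ ε = trans
        (congruent (Nᵀ-linear ε) λ p → regroup a (spoke x p) c (valency x p) S)
        (Nᵀ-affine a (c - S) (spoke x) (valency x) ε)
        where
        regroup : ∀ a x c v s → a * x + (c + v - s) ≡ a * x + (v + (c - s))
        regroup = solve-∀

      -- The terms `Nᵀ (valency x)` cancel between the core and the spokes. What remains beside the
      -- multiple of `a`, namely `S - 2 c`, is the same for every pair, which is why subtracting `σ`
      -- in `g` removes it.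
      σ-Λ : σ (Λ a x) ≡ a * σ x + S - + 2 * c
      σ-Λ = trans (cong (_-_ (core (Λ a x) (base r))) (Nᵀ-spoke-Λ (base r)))
        (collect a (core x (base r)) (Nᵀ (valency x) (base r)) S (Nᵀ (spoke x) (base r)) c)
        where
        collect : ∀ a z v s t c → a * z + (v - s) - (a * t + (v + + 2 * (c - s))) ≡ a * (z - t) + s - + 2 * c
        collect = solve-∀

      g-Λ : ∀ ε → g (Λ a x) ε ≡ a * g x ε
      g-Λ ε = trans (cong₂ (λ s t → core (Λ a x) ε - s - t) (Nᵀ-spoke-Λ ε) σ-Λ)
        (collect a (core x ε) (Nᵀ (valency x) ε) S (Nᵀ (spoke x) ε) c (σ x))
        where
        collect : ∀ a z v s t c o → a * z + (v - s) - (a * t + (v + + 2 * (c - s))) - (a * o + s - + 2 * c) ≡ a * (z - t - o)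
        collect = solve-∀

      -- Subtracting the row sum at 0 removes `S`, leaving `b (valency x p - c)`. The spoke entry
      -- together with `σ` contains the same `valency x p - c`, so multiplying them by `b` cancels
      -- it and leaves a multiple of `a b`.
      h-Λ : ∀ p → h (Λ a x) p ≡ a * b * - (spoke x p + σ x)
      h-Λ p = trans
        (cong₂ (λ v o → v - b * (spoke (Λ a x) p + o)) (cong₂ _-_ (N-Λ a x (suc (suc p))) (N-Λ a x zero)) σ-Λ)
        (collect a m c (valency x p) S (spoke x p) (σ x))
        where
        collect : ∀ a m c v s t o →
          (a + (+ 2 + m) - + 2) * v - ((+ 2 + m) - + 3) * s - ((a + (+ 2 + m) - + 2) * c - ((+ 2 + m) - + 3) * s)
            - (a + m) * (a * t + (c + v - s) + (a * o + s - + 2 * c))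
          ≡ a * (a + m) * - (t + o)
        collect = solve-∀

      -- The coefficient of `c` is b - 2 (n - 3) = e, and that of `σ x` is (n - 3) a, which the
      -- hypothesis on `a` turns into (n - 1) e.
      q-Λ : + 2 * a ≡ (+ n - 1ℤ) * (+ n - + 4) → q (Λ a x) ≡ e * (c + (m + 1ℤ) * σ x)
      q-Λ ha = trans (cong₂ (λ s t → s + (m - 1ℤ) * t) (N-Λ a x zero) σ-Λ)
        (by-adding (- σ x) ha (collect a m c S (σ x)))
        where
        collect : ∀ a m c s o →
          ((a + (+ 2 + m) - + 2) * c - ((+ 2 + m) - + 3) * s) + (m - 1ℤ) * (a * o + s - + 2 * c)
            + - o * (((+ 2 + m) - 1ℤ) * ((+ 2 + m) - + 4))
          ≡ (a - m + + 2) * (c + (m + 1ℤ) * o) + - o * (+ 2 * a)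
        collect = solve-∀

    -- Solving for a preimage, and attaining all invariants

    -- The row sum at 0 kills the entry at {0, 1}, and the other row sums express the entries at {1,
    -- p + 2} as `- N z p`. The total of `δ` is then -2 + 1 times that of the core, so the core has
    -- total 0. This kills its entry at `free r`, and with the core gone the entries `- N z p`
    -- vanish as well.
    rigid : ∀ δ → total δ ≡ 0ℤ → N δ zero ≡ 0ℤ → (∀ p → valency δ p ≡ 0ℤ) → (∀ p → spoke δ p ≡ 0ℤ) →
      (∀ i → core δ (outer r i) ≡ 0ℤ) → core δ (base r) ≡ 0ℤ → core δ (kept r) ≡ 0ℤ → ∀ ε → δ ε ≡ 0ℤ
    rigid δ T≡0 D≡0 v≗0 s≗0 o≗0 b≡0 k≡0 = λ
      { (star zero)    → hub≡0
      ; (star (suc p)) → s≗0 p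
      ; (rest (star p)) → trans (rim p) (cong -_ (N-core≡0 p))
      ; (rest (rest ε)) → core≡0 ε }
      where
      z : Pair (3 ℕ.+ r) → ℤ
      z = core δ
      hub≡0 : δ (star zero) ≡ 0ℤ
      hub≡0 = begin
        δ (star zero)                        ≡⟨ ℤ.+-identityʳ _ ⟨
        δ (star zero) + 0ℤ                   ≡⟨ cong (_+_ (δ (star zero))) (sum-zero s≗0) ⟨
        δ (star zero) + sum (spoke δ)        ≡⟨ D≡0 ⟩
        0ℤ                                   ∎
      rim : ∀ p → δ (rest (star p)) ≡ - N z p
      rim p = by-adding 1ℤ (trans (cong (_+ (δ (rest (star p)) + N z p)) (sym (s≗0 p))) (v≗0 p)) (collect (δ (rest (star p))) (N z p))
        where
        collect : ∀ x y → x + 1ℤ * 0ℤ ≡ - y + 1ℤ * (0ℤ + (x + y))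
        collect = solve-∀
      total-core≡0 : total z ≡ 0ℤ
      total-core≡0 = by-adding -1ℤ (trans (sym T≡) T≡0) (collect (total z))
        where
        collect : ∀ t → t + -1ℤ * 0ℤ ≡ 0ℤ + -1ℤ * (0ℤ + ((-1ℤ) * (+ 2 * t) + t))
        collect = solve-∀
        T≡ : total δ ≡ 0ℤ + (-1ℤ * (+ 2 * total z) + total z)
        T≡ = cong₂ _+_ D≡0 (cong (_+ total z) (begin
          sum (λ p → δ (rest (star p)))    ≡⟨ sum-cong-≗ (λ p → trans (rim p) (sym (ℤ.-1*i≡-i (N z p)))) ⟩
          sum (λ p → -1ℤ * N z p)          ≡⟨ homogeneous sum-isLinear -1ℤ (N z) ⟩
          -1ℤ * sum (N z)                  ≡⟨ cong (-1ℤ *_) (handshake z) ⟩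
          -1ℤ * (+ 2 * total z)            ∎))
      core≡0 : ∀ ε → z ε ≡ 0ℤ
      core≡0 = cover-triangle r o≗0 b≡0 (trans (sym (total-free r z o≗0 b≡0 k≡0)) total-core≡0) k≡0
      N-core≡0 : ∀ p → N z p ≡ 0ℤ
      N-core≡0 p = trans (congruent (N-linear p) core≡0) (trans (N-const 0ℤ p) (ℤ.*-zeroʳ (m - 1ℤ)))

    -- c, S and v are the values of N x zero, total x and valency x that Λ a x = y forces,
    -- up to adding a constant to x.  The free entry of the triangle is chosen to make total x = S.

    module Solve (y : Pair n → ℤ) (γ : Fin (outerCount r) → ℤ) (κ : ℤ) (t : Fin (3 ℕ.+ r) → ℤ) (c : ℤ) where

      private
        S : ℤ
        S = + 2 * c + σ y

        v : Fin (3 ℕ.+ r) → ℤ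
        v p = a * t p + (spoke y p + (σ y + c))

        -- These are the values of `g x`; since the spokes of `x` are to be `- t`, the core of `x`
        -- is obtained by subtracting `Nᵀ t`. The core enters `total x` with coefficient -2 + 1, the
        -- -2 coming from the entries at {1, p + 2}, and the total is chosen accordingly to give
        -- `total x ≡ S`.
        completion : Σ[ z ∈ (Pair (3 ℕ.+ r) → ℤ) ] (∀ i → z (outer r i) ≡ γ i) × z (base r) ≡ 0ℤ × z (kept r) ≡ κ
          × total z ≡ c + sum (λ p → v p + t p) - S + total (Nᵀ t)
        completion = prescribe r γ 0ℤ κ (c + sum (λ p → v p + t p) - S + total (Nᵀ t))

        γ̂ z : Pair (3 ℕ.+ r) → ℤ
        γ̂ = proj₁ completion
        z ε = γ̂ ε - Nᵀ t ε

      -- Shifting `x` by a constant allows `σ x = 0`, whereupon `h-Λ` forces the spokes. The entries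
      -- at {0, 1} and {1, p + 2} are then solved from the row sums `c` and `v p`.
      solution : Pair n → ℤ
      solution (star zero)     = c + sum t
      solution (star (suc p))  = -1ℤ * t p
      solution (rest (star p)) = v p + t p - N z p
      solution (rest (rest ε)) = z ε

      private
        x δ : Pair n → ℤ
        x = solution
        δ ε = Λ a x ε - y ε

        sum-spoke : sum (spoke x) ≡ -1ℤ * sum t
        sum-spoke = homogeneous sum-isLinear -1ℤ t

        N-zero : N x zero ≡ c
        N-zero = trans (cong (_+_ (c + sum t)) sum-spoke) (cancel c (sum t))
          where
          cancel : ∀ c t → c + t + -1ℤ * t ≡ c
          cancel = solve-∀

        valency-x : ∀ p → valency x p ≡ v p
        valency-x p = cancel (t p) (v p) (N z p)
          where
          cancel : ∀ t v s → -1ℤ * t + (v + t - s + s) ≡ v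
          cancel = solve-∀

        total-z : total z ≡ c + sum (λ p → v p + t p) - S
        total-z = trans (subtractive total-linear γ̂ (Nᵀ t))
          (trans (cong (_- total (Nᵀ t)) (proj₂ (proj₂ (proj₂ (proj₂ completion)))))
            (cancel (c + sum (λ p → v p + t p) - S) (total (Nᵀ t))))
          where
          cancel : ∀ s t → s + t - t ≡ s
          cancel = solve-∀

        total-x : total x ≡ S
        total-x = trans
          (cong₂ (λ D R → D + (R + total z)) N-zero
            (trans (subtractive sum-isLinear (λ p → v p + t p) (N z)) (cong (_-_ (sum (λ p → v p + t p))) (handshake z))))
          (by-adding -1ℤ total-z (collect c (sum (λ p → v p + t p)) (total z) S))
          where
          collect : ∀ c u z s → c + (u - + 2 * z + z) + -1ℤ * (c + u - s) ≡ s + -1ℤ * z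
          collect = solve-∀

      -- The difference `δ` meets the hypotheses of `rigid`, so the congruences left out of the list
      -- of invariants follow from the kept ones and from both totals being 0.
      solution-correct : + 2 * a ≡ (+ n - 1ℤ) * (+ n - + 4) → total y ≡ 0ℤ →
        (∀ i → g y (outer r i) ≡ a * γ i) → g y (kept r) ≡ a * κ → (∀ p → h y p ≡ a * b * t p) →
        q y ≡ e * c → ∀ ε → y ε ≡ Λ a x ε
      solution-correct ha total-y g≡ gk≡ h≡ q≡ ε = sym (difference-zero (δ≡0 ε))
        where
        difference-zero : ∀ {u w} → u - w ≡ 0ℤ → u ≡ w
        difference-zero {u} {w} p = by-adding 1ℤ p (collect u w)
          where
          collect : ∀ u w → u + 1ℤ * 0ℤ ≡ w + 1ℤ * (u - w)
          collect = solve-∀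

        total-δ : total δ ≡ 0ℤ
        total-δ = trans (subtractive total-linear (Λ a x) y) (cong₂ _-_ (total-Λ a ha x) total-y)

        N-zero-δ : N δ zero ≡ 0ℤ
        N-zero-δ = trans (subtractive (N-linear zero) (Λ a x) y)
          (trans (cong (_- N y zero) (trans (N-Λ a x zero)
            (cong₂ (λ d s → (a + + n - + 2) * d - (+ n - + 3) * s) N-zero total-x)))
            (by-adding -1ℤ q≡ (collect a m c (σ y) (N y zero))))
          where
          collect : ∀ a m c o d →
            (a + (+ 2 + m) - + 2) * c - ((+ 2 + m) - + 3) * (+ 2 * c + o) - d + -1ℤ * ((a - m + + 2) * c)
            ≡ 0ℤ + -1ℤ * (d + (m - 1ℤ) * o)
          collect = solve-∀

        -- `h y p` measures a row sum relative to the one at 0, which `q≡` pins down.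
        valency-δ : ∀ p → valency δ p ≡ 0ℤ
        valency-δ p = trans (subtractive (N-linear (suc (suc p))) (Λ a x) y)
          (trans (cong (_- valency y p) (trans (N-Λ a x (suc (suc p)))
            (cong₂ (λ d s → (a + + n - + 2) * d - (+ n - + 3) * s) (valency-x p) total-x)))
            (by-adding -1ℤ q≡ (by-adding -1ℤ (h≡ p) (collect a m c (σ y) (N y zero) (spoke y p) (t p) (valency y p)))))
          where
          collect : ∀ a m c o d w t v →
            (a + (+ 2 + m) - + 2) * (a * t + (w + (o + c))) - ((+ 2 + m) - + 3) * (+ 2 * c + o) - v
              + -1ℤ * ((a - m + + 2) * c) + -1ℤ * (a * (a + m) * t)
            ≡ 0ℤ + -1ℤ * (d + (m - 1ℤ) * o) + -1ℤ * (v - d - (a + m) * (w + o))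
          collect = solve-∀

        spoke-δ : ∀ p → spoke δ p ≡ 0ℤ
        spoke-δ p = trans
          (cong₂ (λ d s → a * (-1ℤ * t p) + (d - s) - spoke y p) (cong₂ _+_ N-zero (valency-x p)) total-x)
          (collect a c (t p) (spoke y p) (σ y))
          where
          collect : ∀ a c t w o → a * (-1ℤ * t) + (c + (a * t + (w + (o + c))) - (+ 2 * c + o)) - w ≡ 0ℤ
          collect = solve-∀

        core-δ : ∀ ε → core δ ε ≡ a * γ̂ ε - g y ε
        core-δ ε = trans
          (cong₂ (λ d s → a * z ε + (d - s) - core y ε)
            (trans (congruent (Nᵀ-linear ε) valency-x) (Nᵀ-affine a (σ y + c) t (spoke y) ε)) total-x)
          (collect a c (γ̂ ε) (Nᵀ t ε) (Nᵀ (spoke y) ε) (σ y) (core y ε))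
          where
          collect : ∀ a c γ t w o z →
            a * (γ - t) + ((a * t + (w + + 2 * (o + c))) - (+ 2 * c + o)) - z ≡ a * γ - (z - w - o)
          collect = solve-∀

        core-δ≡0 : ∀ ε {k} → γ̂ ε ≡ k → g y ε ≡ a * k → core δ ε ≡ 0ℤ
        core-δ≡0 ε {k} γ̂≡ g≡ = trans (core-δ ε)
          (trans (cong₂ (λ s u → a * s - u) γ̂≡ g≡) (ℤ.+-inverseʳ (a * k)))

        g-base : g y (base r) ≡ a * 0ℤ
        g-base = trans (ℤ.+-inverseʳ (σ y)) (sym (ℤ.*-zeroʳ a))

        δ≡0 : ∀ ε → δ ε ≡ 0ℤ
        δ≡0 = rigid δ total-δ N-zero-δ valency-δ spoke-δ
          (λ i → core-δ≡0 (outer r i) (proj₁ (proj₂ completion) i) (g≡ i))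
          (core-δ≡0 (base r) (proj₁ (proj₂ (proj₂ completion))) g-base)
          (core-δ≡0 (kept r) (proj₁ (proj₂ (proj₂ (proj₂ completion)))) gk≡)

    -- With all spokes and the entry at `base r` zero, `σ y` vanishes and the invariants can be read
    -- off: `q` is the entry at {0, 1}, `g` is the core, and `h` fixes the entries at {1, p + 2}.
    -- The entry at `free r` makes the total 0.
    attain : ∀ (γ : Fin (outerCount r) → ℤ) κ (η : Fin (3 ℕ.+ r) → ℤ) w →
      Σ[ y ∈ (Pair n → ℤ) ] total y ≡ 0ℤ × (∀ i → g y (outer r i) ≡ γ i) × g y (kept r) ≡ κ
        × (∀ p → h y p ≡ η p) × q y ≡ w
    attain γ κ η w = y , total-y , (λ i → trans (g≡ (outer r i)) (proj₁ (proj₂ completion) i))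
      , trans (g≡ (kept r)) (proj₁ (proj₂ (proj₂ (proj₂ completion)))) , h≡ , q≡
      where
      completion : Σ[ z ∈ (Pair (3 ℕ.+ r) → ℤ) ] (∀ i → z (outer r i) ≡ γ i) × z (base r) ≡ 0ℤ × z (kept r) ≡ κ
        × total z ≡ (m + 1ℤ) * w + sum η
      completion = prescribe r γ 0ℤ κ ((m + 1ℤ) * w + sum η)

      z : Pair (3 ℕ.+ r) → ℤ
      z = proj₁ completion

      y : Pair n → ℤ
      y (star zero)     = w
      y (star (suc p))  = 0ℤ
      y (rest (star p)) = η p + w - N z p
      y (rest (rest ε)) = z ε

      Nᵀ-spoke : ∀ ε → Nᵀ (spoke y) ε ≡ 0ℤ
      Nᵀ-spoke ε = homogeneous (Nᵀ-linear ε) 0ℤ (λ _ → 0ℤ)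

      σ≡0 : σ y ≡ 0ℤ
      σ≡0 = cong₂ _-_ (proj₁ (proj₂ (proj₂ completion))) (Nᵀ-spoke (base r))

      N-zero : N y zero ≡ w
      N-zero = trans (cong (_+_ w) (sum-zero {3 ℕ.+ r} λ _ → refl)) (ℤ.+-identityʳ w)

      g≡ : ∀ ε → g y ε ≡ z ε
      g≡ ε = trans (cong₂ (λ s o → z ε - s - o) (Nᵀ-spoke ε) σ≡0) (trans (ℤ.+-identityʳ _) (ℤ.+-identityʳ _))

      q≡ : q y ≡ w
      q≡ = trans (cong₂ (λ d o → d + (m - 1ℤ) * o) N-zero σ≡0) (collect m w)
        where
        collect : ∀ m w → w + (m - 1ℤ) * 0ℤ ≡ w
        collect = solve-∀

      h≡ : ∀ p → h y p ≡ η p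
      h≡ p = trans (cong₂ (λ d o → valency y p - d - b * (0ℤ + o)) N-zero σ≡0) (collect b w (η p) (N z p))
        where
        collect : ∀ b w η s → 0ℤ + (η + w - s + s) - w - b * (0ℤ + 0ℤ) ≡ η
        collect = solve-∀

      total-y : total y ≡ 0ℤ
      total-y = trans
        (cong₂ (λ d s → d + (s + total z)) N-zero
          (trans (subtractive sum-isLinear (λ p → η p + w) (N z))
            (cong₂ _-_ (trans (∑-distrib-+ η (λ _ → w)) (cong (_+_ (sum η)) (sum-const (3 ℕ.+ r) w))) (handshake z))))
        (by-adding -1ℤ (proj₂ (proj₂ (proj₂ (proj₂ completion)))) (collect m w (sum η) (total z)))
        where
        collect : ∀ m w s t → w + (s + m * w - + 2 * t + t) + -1ℤ * ((m + 1ℤ) * w + s) ≡ 0ℤ + -1ℤ * t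
        collect = solve-∀

  -- Homomorphisms and annihilators of abelian groups

  private
    variable
      ℓ₁ ℓ₂ ℓ₃ ℓ₄ : Level

  module _ (G : AbelianGroup ℓ₁ ℓ₂) (H : AbelianGroup ℓ₃ ℓ₄) where

    private
      module G = AbelianGroup G
      module H = AbelianGroup H
      open AbelianGroupProperties H using (identityˡ-unique; inverseˡ-unique)
      open Mult G.commutativeMonoid using () renaming (_×_ to _·ᴳ_)
      open Mult H.commutativeMonoid using () renaming (_×_ to _·ᴴ_)

    additive⇒Hom : (f : G.Carrier → H.Carrier) → (∀ {x y} → x G.≈ y → f x H.≈ f y) →
                   (∀ x y → f (x G.∙ y) H.≈ f x H.∙ f y) → Hom G H
    additive⇒Hom f f-cong f-∙ = record
      { ⟦_⟧ = f
      ; isGroupHomomorphism = record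
        { isMonoidHomomorphism = record
          { isMagmaHomomorphism = record
            { isRelHomomorphism = record { cong = f-cong }
            ; homo = f-∙
            }
          ; ε-homo = f-ε
          }
        ; ⁻¹-homo = λ x → inverseˡ-unique (f (x G.⁻¹)) (f x)
            (H.trans (H.sym (f-∙ (x G.⁻¹) x)) (H.trans (f-cong (G.inverseˡ x)) f-ε))
        }
      }
      where
      f-ε : f G.ε H.≈ H.ε
      f-ε = identityˡ-unique (f G.ε) (f G.ε) (H.trans (H.sym (f-∙ G.ε G.ε)) (f-cong (G.identityˡ G.ε)))

    module _ (φ : Hom G H) where

      private module φ = GroupHomomorphism φ

      Hom-multiple : ∀ k x → φ.⟦ k ·ᴳ x ⟧ H.≈ k ·ᴴ φ.⟦ x ⟧
      Hom-multiple zero    x = φ.ε-homo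
      Hom-multiple (suc k) x = H.trans (φ.homo x (k ·ᴳ x)) (H.∙-congˡ (Hom-multiple k x))

      Hom-difference : ∀ x y → φ.⟦ x G.- y ⟧ H.≈ φ.⟦ x ⟧ H.- φ.⟦ y ⟧
      Hom-difference x y = H.trans (φ.homo x (y G.⁻¹)) (H.∙-congˡ (φ.⁻¹-homo y))

  infix 4 _Annihilates_

  _Annihilates_ : ℕ → AbelianGroup ℓ₁ ℓ₂ → Set _
  k Annihilates G = ∀ x → k · x ≈ ε
    where
    open AbelianGroup G
    open Mult commutativeMonoid using () renaming (_×_ to _·_)

  module _ (G : AbelianGroup ℓ₁ ℓ₂) where

    private
      open AbelianGroup G
      open Mult commutativeMonoid using (×-congʳ; ×-congˡ; ×-assocˡ) renaming (_×_ to _·_)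

      multiple-ε : ∀ k → k · ε ≈ ε
      multiple-ε zero    = AbelianGroup.refl G
      multiple-ε (suc k) = AbelianGroup.trans G (identityˡ (k · ε)) (multiple-ε k)

    annihilates-*ˡ : ∀ j {k} → k Annihilates G → j ℕ.* k Annihilates G
    annihilates-*ˡ j {k} kG x = AbelianGroup.trans G (AbelianGroup.sym G (×-assocˡ x j k))
      (AbelianGroup.trans G (×-congʳ j (kG x)) (multiple-ε j))

    annihilates-*ʳ : ∀ k {j} → j Annihilates G → j ℕ.* k Annihilates G
    annihilates-*ʳ k {j} jG x = AbelianGroup.trans G (×-congˡ {x} (ℕ.*-comm j k)) (annihilates-*ˡ k {j} jG x)

    annihilates-^ : ∀ {j} k → j Annihilates G → j Annihilates G ^ k
    annihilates-^ {j} k jG x i = AbelianGroup.trans G (component j) (jG (x i))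
      where
      open Mult (AbelianGroup.commutativeMonoid (G ^ k)) using () renaming (_×_ to _·^_)
      component : ∀ j → (j ·^ x) i ≈ j · x i
      component zero    = AbelianGroup.refl G
      component (suc j) = ∙-congˡ (component j)

  -- The product of the exponents serves in place of their least common multiple: only some nonzero
  -- exponent is wanted.
  annihilates-⊕ : (G : AbelianGroup ℓ₁ ℓ₂) (H : AbelianGroup ℓ₃ ℓ₄) → ∀ {j k} →
                  j Annihilates G → k Annihilates H → j ℕ.* k Annihilates G ⊕ H
  annihilates-⊕ G H {j} {k} jG kH (x , y) =
      G.trans (proj₁ (component (j ℕ.* k))) (annihilates-*ʳ G k {j} jG x)
    , H.trans (proj₂ (component (j ℕ.* k))) (annihilates-*ˡ H j {k} kH y)
    where
    module G = AbelianGroup G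
    module H = AbelianGroup H
    open Mult G.commutativeMonoid using () renaming (_×_ to _·ᴳ_)
    open Mult H.commutativeMonoid using () renaming (_×_ to _·ᴴ_)
    open Mult (AbelianGroup.commutativeMonoid (G ⊕ H)) using () renaming (_×_ to _·_)
    component : ∀ i → proj₁ (i · (x , y)) G.≈ i ·ᴳ x × proj₂ (i · (x , y)) H.≈ i ·ᴴ y
    component zero    = G.refl , H.refl
    component (suc i) = G.∙-congˡ (proj₁ (component i)) , H.∙-congˡ (proj₂ (component i))

  open Mult (AbelianGroup.commutativeMonoid ℤ.+-0-abelianGroup) using () renaming (_×_ to _·ᶻ_)

  multiple-ℤ : ∀ k x → k ·ᶻ x ≡ + k * x
  multiple-ℤ zero    x = sym (ℤ.*-zeroˡ x)
  multiple-ℤ (suc k) x = trans (cong (_+_ x) (multiple-ℤ k x)) (sym (ℤ.suc-* (+ k) x))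

  module _ (G : AbelianGroup ℓ₁ ℓ₂) (H : AbelianGroup ℓ₃ ℓ₄) (φ : Hom G H) where

    open Mult (AbelianGroup.commutativeMonoid H) using () renaming (_×_ to _·ᴴ_)
    open Mult (AbelianGroup.commutativeMonoid (cokernel G H φ)) using () renaming (_×_ to _·ᶜ_)

    -- A cokernel keeps the operation and changes only the equality, so the multiples agree even
    -- propositionally.
    cokernel-multiple : ∀ k x → k ·ᶜ x ≡ k ·ᴴ x
    cokernel-multiple zero    x = refl
    cokernel-multiple (suc k) x = cong (AbelianGroup._∙_ H x) (cokernel-multiple k x)

  annihilates-𝐙 : ∀ m → m Annihilates 𝐙 m
  annihilates-𝐙 m x = x , trans (ℤ.+-identityʳ _)
    (trans (cokernel-multiple ℤ.+-0-abelianGroup ℤ.+-0-abelianGroup (mulBy (+ m)) m x) (multiple-ℤ m x))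

  -- A criterion for identifying the critical group

  module _ (Γ : FiniteGraph) (T : AbelianGroup ℓ₁ ℓ₂)
           (d : Hom (ℤ^V Γ) ℤ.+-0-abelianGroup) (Φ : Hom (ℤ^V Γ) T) where

    private
      H : AbelianGroup _ _
      H = ℤ^V Γ
      φ : Hom H H
      φ = laplacian Γ
      module H = AbelianGroup H
      module T = AbelianGroup T
      module φ = GroupHomomorphism φ
      module d = GroupHomomorphism d
      module Φ = GroupHomomorphism Φ
      module TP = AbelianGroupProperties T
      open Mult H.commutativeMonoid using () renaming (_×_ to _·ᴴ_)
      open Mult (AbelianGroup.commutativeMonoid (cokernel H H φ)) using () renaming (_×_ to _·ᶜ_)

    -- The torsion classes are those with `d` zero. If j x lies in the image then j times `d x` is
    -- 0, and the integers have no torsion; conversely, if `d y` is 0 then `Φ` kills k y, which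
    -- exactness puts in the image. On these classes `Φ` is well defined, injective by exactness and
    -- surjective by the last condition on `Φ`.
    criticalGroup-≅ :
      (∀ g → d.⟦ φ.⟦ g ⟧ ⟧ ≡ 0ℤ) → (∀ g → Φ.⟦ φ.⟦ g ⟧ ⟧ T.≈ T.ε) →
      (∀ y → d.⟦ y ⟧ ≡ 0ℤ → Φ.⟦ y ⟧ T.≈ T.ε → ∃[ g ] y H.≈ φ.⟦ g ⟧) →
      (∀ t → ∃[ y ] d.⟦ y ⟧ ≡ 0ℤ × Φ.⟦ y ⟧ T.≈ t) →
      ∀ k → .{{NonZero k}} → k Annihilates T →
      criticalGroup Γ ≅ T
    criticalGroup-≅ dφ≡0 Φφ≈ε exact onto k kT = (λ (x , _) → Φ.⟦ x ⟧) , record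
      { isGroupMonomorphism = record
        { isGroupHomomorphism = GroupHomomorphism.isGroupHomomorphism
            (additive⇒Hom (criticalGroup Γ) T (λ (x , _) → Φ.⟦ x ⟧)
              (λ {x} {y} → Φ-cong (proj₁ x) (proj₁ y)) (λ (x , _) (y , _) → Φ.homo x y))
        ; injective = λ {(x , p)} {(y , q)} Φx≈Φy → exact (x H.- y)
            (trans (Hom-difference H ℤ.+-0-abelianGroup d x y)
              (cong₂ _-_ (torsion⇒d≡0 x p) (torsion⇒d≡0 y q)))
            (T.trans (Hom-difference H T Φ x y) (TP.x≈y⇒x∙y⁻¹≈ε Φx≈Φy))
        }
      ; surjective = λ t → let (y , dy≡0 , Φy≈t) = onto t in
          (y , d≡0⇒torsion y dy≡0) , λ {(z , _)} z≈y → T.trans (Φ-cong z y z≈y) Φy≈t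
      }
      where
      Φ-cong : ∀ x y → AbelianGroup._≈_ (cokernel H H φ) x y → Φ.⟦ x ⟧ T.≈ Φ.⟦ y ⟧
      Φ-cong x y (g , x-y≈φg) = TP.x∙y⁻¹≈ε⇒x≈y Φ.⟦ x ⟧ Φ.⟦ y ⟧
        (T.trans (T.sym (Hom-difference H T Φ x y)) (T.trans (Φ.⟦⟧-cong x-y≈φg) (Φφ≈ε g)))

      multiple-difference : ∀ j x → (j ·ᶜ x) H.- H.ε H.≈ j ·ᴴ x
      multiple-difference j x = λ v →
        trans (ℤ.+-identityʳ ((j ·ᶜ x) v)) (cong (λ z → z v) (cokernel-multiple H H φ j x))

      torsion⇒d≡0 : ∀ x → IsTorsion (cokernel H H φ) x → d.⟦ x ⟧ ≡ 0ℤ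
      torsion⇒d≡0 x (j@(suc _) , _ , g , jx≈φg) = ℤ.*-cancelˡ-≡ (+ j) d.⟦ x ⟧ 0ℤ (begin
        + j * d.⟦ x ⟧              ≡⟨ multiple-ℤ j d.⟦ x ⟧ ⟨
        j ·ᶻ d.⟦ x ⟧               ≡⟨ Hom-multiple H ℤ.+-0-abelianGroup d j x ⟨
        d.⟦ j ·ᴴ x ⟧               ≡⟨ d.⟦⟧-cong (H.trans (H.sym (multiple-difference j x)) jx≈φg) ⟩
        d.⟦ φ.⟦ g ⟧ ⟧              ≡⟨ dφ≡0 g ⟩
        0ℤ                         ≡⟨ ℤ.*-zeroʳ (+ j) ⟨
        + j * 0ℤ                   ∎)

      d≡0⇒torsion : ∀ y → d.⟦ y ⟧ ≡ 0ℤ → IsTorsion (cokernel H H φ) y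
      d≡0⇒torsion y dy≡0 =
        let (g , ky≈φg) = exact (k ·ᴴ y)
              (trans (Hom-multiple H ℤ.+-0-abelianGroup d k y)
                (trans (multiple-ℤ k d.⟦ y ⟧) (trans (cong (+ k *_) dy≡0) (ℤ.*-zeroʳ (+ k)))))
              (T.trans (Hom-multiple H T Φ k y) (kT Φ.⟦ y ⟧))
        in k , ℕ.>-nonZero (ℕ.>-nonZero⁻¹ k) , g , H.trans (multiple-difference k y) ky≈φg

  -- Congruences, parity and exact division

  𝐙-≡ : ∀ m {x y} → x ≡ y → AbelianGroup._≈_ (𝐙 m) x y
  𝐙-≡ m x≡y = AbelianGroup.reflexive (𝐙 m) x≡y

  𝐙-ε : ∀ m {x} k → x ≡ + m * k → AbelianGroup._≈_ (𝐙 m) x 0ℤ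
  𝐙-ε m k x≡mk = k , trans (ℤ.+-identityʳ _) x≡mk

  ε-𝐙 : ∀ m {x} → AbelianGroup._≈_ (𝐙 m) x 0ℤ → ∃[ k ] x ≡ + m * k
  ε-𝐙 m (k , p) = k , trans (sym (ℤ.+-identityʳ _)) p

  outerCount-double : ∀ r → outerCount r ℕ.* 2 ≡ (5 ℕ.+ r) ℕ.* r
  outerCount-double zero    = refl
  outerCount-double (suc r) = begin
    ((3 ℕ.+ r) ℕ.+ outerCount r) ℕ.* 2           ≡⟨ ℕ.*-distribʳ-+ 2 (3 ℕ.+ r) (outerCount r) ⟩
    (3 ℕ.+ r) ℕ.* 2 ℕ.+ outerCount r ℕ.* 2       ≡⟨ cong ((3 ℕ.+ r) ℕ.* 2 ℕ.+_) (outerCount-double r) ⟩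
    (3 ℕ.+ r) ℕ.* 2 ℕ.+ (5 ℕ.+ r) ℕ.* r          ≡⟨ expand r ⟩
    (6 ℕ.+ r) ℕ.* (1 ℕ.+ r)                      ∎
    where
    expand : ∀ r → (3 ℕ.+ r) ℕ.* 2 ℕ.+ (5 ℕ.+ r) ℕ.* r ≡ (6 ℕ.+ r) ℕ.* (1 ℕ.+ r)
    expand = ℕSolver.solve-∀

  ≡-quotient : ∀ {m} q d .{{_ : NonZero d}} → m ≡ q ℕ.* d → q ≡ m / d
  ≡-quotient q d refl = sym (m*n/n≡m q d)

  even⊎odd : ∀ r → (∃[ k ] r ≡ k ℕ.* 2) ⊎ (∃[ k ] r ≡ 1 ℕ.+ k ℕ.* 2)
  even⊎odd zero    = inj₁ (0 , refl)
  even⊎odd (suc r) with even⊎odd r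
  ... | inj₁ (k , refl) = inj₂ (k , refl)
  ... | inj₂ (k , refl) = inj₁ (suc k , refl)

  2∤1+even : ∀ k → 2 ∤ 1 ℕ.+ k ℕ.* 2
  2∤1+even k 2∣ = from-no (2 ∣? 1) (∣m+n∣m⇒∣n (subst (2 ∣_) (ℕ.+-comm 1 (k ℕ.* 2)) 2∣) (n∣m*n k))

  -- Every equation here has a variable on one side, so all can be matched with `refl` together; at
  -- the point of use those variables become quotients and truncated differences.
  relabel : ∀ r m₁ m₂ k m₃ m₄ {n m₁′ m₂′ k′ m₃′ m₄′ j′} → n ≡ 5 ℕ.+ r →
    m₁ ≡ m₁′ → m₂ ≡ m₂′ → k ≡ k′ → m₃ ≡ m₃′ → m₄ ≡ m₄′ → 3 ℕ.+ r ≡ j′ →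
    criticalGroup (KG (5 ℕ.+ r) 2) ≅ 𝐙 m₁ ⊕ 𝐙 m₂ ^ k ⊕ 𝐙 m₃ ⊕ 𝐙 m₄ ^ (3 ℕ.+ r) →
    criticalGroup (KG n 2) ≅ 𝐙 m₁′ ⊕ 𝐙 m₂′ ^ k′ ⊕ 𝐙 m₃′ ⊕ 𝐙 m₄′ ^ j′
  relabel _ _ _ _ _ _ refl refl refl refl refl refl refl iso = iso

  -- Assembling the isomorphism

  -- Here f u = a and f v = e; the functionals g (kept r) modulo f u and q modulo f v are
  -- combined into one modulo f and one modulo f u v.

  module Decomposition (r f u v : ℕ) (s t : ℤ) .{{_ : NonZero f}} .{{_ : NonZero u}} .{{_ : NonZero v}}
    (bézout : s * + u + t * + v ≡ 1ℤ)
    (two-fu : 2 ℕ.* (f ℕ.* u) ≡ (4 ℕ.+ r) ℕ.* (1 ℕ.+ r))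
    (fv+fu : f ℕ.* u ℕ.+ 2 ≡ f ℕ.* v ℕ.+ (3 ℕ.+ r))
    where

    private
      M n a : ℕ
      M = 3 ℕ.+ r
      n = 5 ℕ.+ r
      a = f ℕ.* u

    open Invariants r (+ a) using (σ; g; q; h; g-linear; q-linear; h-linear; g-Λ; h-Λ; q-Λ; attain; e)
    open Linear

    private
      ha : + 2 * + a ≡ (+ n - 1ℤ) * (+ n - + 4)
      ha = trans (sym (ℤ.pos-* 2 a)) (trans (cong +_ two-fu) (ℤ.pos-* (4 ℕ.+ r) (1 ℕ.+ r)))

      -- `fv+fu` is e = f v stated over the naturals without subtraction.
      he : + a - + M + + 2 ≡ + (f ℕ.* v)
      he = by-adding 1ℤ (cong +_ fv+fu) (collect (+ a) (+ M) (+ (f ℕ.* v)))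
        where
        collect : ∀ a m x → a - m + + 2 + 1ℤ * (x + m) ≡ x + 1ℤ * (a + + 2)
        collect = solve-∀

      Γ : FiniteGraph
      Γ = KG n 2

      ab : ℕ
      ab = a ℕ.* (a ℕ.+ M)

      T : AbelianGroup _ _
      T = 𝐙 f ⊕ 𝐙 a ^ outerCount r ⊕ 𝐙 (f ℕ.* u ℕ.* v) ⊕ 𝐙 ab ^ M

      module T = AbelianGroup T

      -- By Bézout this change of coordinates has determinant -1 in absolute terms a unit, with
      -- inverse `g = t Q - u P` and `q = s Q + v P`. It carries the conditions modulo f u and f v
      -- to conditions modulo f and f u v.
      P Q : (Pair n → ℤ) → ℤ
      P y = t * q y - s * g y (kept r)
      Q y = + v * g y (kept r) + + u * q y

      P-linear : Linear P
      P-linear = minus-linear (scale-linear t q-linear) (scale-linear s (g-linear (kept r)))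

      Q-linear : Linear Q
      Q-linear = +-linear (scale-linear (+ v) (g-linear (kept r))) (scale-linear (+ u) q-linear)

      +ab : + ab ≡ + a * (+ a + + M)
      +ab = ℤ.pos-* a (a ℕ.+ M)

      +fuv : + (f ℕ.* u ℕ.* v) ≡ + f * + u * + v
      +fuv = trans (ℤ.pos-* (f ℕ.* u) v) (cong (_* + v) (ℤ.pos-* f u))

    Φ′ : (Pair n → ℤ) → T.Carrier
    Φ′ y = P y , (λ i → g y (outer r i)) , Q y , h y

    Φ′-ε : ∀ y p (γ : Fin (outerCount r) → ℤ) k (η : Fin M → ℤ) → P y ≡ + f * p → (∀ i → g y (outer r i) ≡ + a * γ i) → Q y ≡ + f * + u * + v * k →
      (∀ i → h y i ≡ + a * (+ a + + M) * η i) → Φ′ y T.≈ T.ε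
    Φ′-ε y p γ k η Py gy Qy hy =
        𝐙-ε f p Py
      , (λ i → 𝐙-ε a (γ i) (gy i))
      , 𝐙-ε (f ℕ.* u ℕ.* v) k (trans Qy (cong (_* k) (sym +fuv)))
      , (λ i → 𝐙-ε ab (η i) (trans (hy i) (cong (_* η i) (sym +ab))))

    Φ′-Λ : ∀ x → Φ′ (Λ (+ a) x) T.≈ T.ε
    Φ′-Λ x = Φ′-ε (Λ (+ a) x) (t * (+ v * c) - s * (+ u * k)) (λ i → g x (outer r i)) (k + c) (λ i → - (spoke x i + σ x))
      (trans (cong₂ (λ q g → t * q - s * g) q≡ g≡) (collect-P (+ f) (+ u) (+ v) s t c k))
      (λ i → g-Λ x (outer r i))
      (trans (cong₂ (λ q g → + v * g + + u * q) q≡ g≡) (collect-Q (+ f) (+ u) (+ v) c k))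
      (h-Λ x)
      where
      k c : ℤ
      k = g x (kept r)
      c = N x zero + (+ M + 1ℤ) * σ x
      q≡ : q (Λ (+ a) x) ≡ + f * + v * c
      q≡ = trans (q-Λ x ha) (cong (_* c) (trans he (ℤ.pos-* f v)))
      g≡ : g (Λ (+ a) x) (kept r) ≡ + f * + u * k
      g≡ = trans (g-Λ x (kept r)) (cong (_* k) (ℤ.pos-* f u))
      collect-P : ∀ f u v s t c k → t * (f * v * c) - s * (f * u * k) ≡ f * (t * (v * c) - s * (u * k))
      collect-P = solve-∀
      collect-Q : ∀ f u v c k → v * (f * u * k) + u * (f * v * c) ≡ f * u * v * (k + c)
      collect-Q = solve-∀

    exact′ : ∀ y → total y ≡ 0ℤ → Φ′ y T.≈ T.ε → ∃[ x ] y ≗ Λ (+ a) x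
    exact′ y total-y (P≈ , g≈ , Q≈ , h≈) = solution , solution-correct ha total-y
      (λ i → proj₂ (ε-𝐙 a (g≈ i))) gk≡
      (λ i → trans (proj₂ (ε-𝐙 ab (h≈ i))) (cong (_* proj₁ (h≈ i)) +ab)) q≡
      where
      p k κ c : ℤ
      p = proj₁ P≈
      k = proj₁ Q≈
      -- Substituting `P = f p` and `Q = f u v k` into the inverse change of coordinates and
      -- dividing by f u and f v respectively gives `κ` and `c`.
      κ = t * + v * k - p
      c = s * + u * k + p
      open Invariants.Solve r (+ a) y (λ i → proj₁ (g≈ i)) κ (λ i → proj₁ (h≈ i)) c
      P≡ : P y ≡ + f * p
      P≡ = proj₂ (ε-𝐙 f P≈)
      Q≡ : Q y ≡ + f * + u * + v * k
      Q≡ = trans (proj₂ (ε-𝐙 (f ℕ.* u ℕ.* v) Q≈)) (cong (_* k) +fuv)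
      gk≡ : g y (kept r) ≡ + a * κ
      gk≡ = trans
        (by-adding (- g y (kept r)) bézout (by-adding (- + u) P≡ (by-adding t Q≡ (collect (+ f) (+ u) (+ v) s t (g y (kept r)) (q y) p k))))
        (cong (_* κ) (sym (ℤ.pos-* f u)))
        where
        collect : ∀ f u v s t G q p k →
          G + - G * 1ℤ + - u * (f * p) + t * (f * u * v * k)
          ≡ f * u * (t * v * k - p) + - G * (s * u + t * v) + - u * (t * q - s * G) + t * (v * G + u * q)
        collect = solve-∀
      q≡ : q y ≡ e * c
      q≡ = trans
        (by-adding (- q y) bézout (by-adding (+ v) P≡ (by-adding s Q≡ (collect (+ f) (+ u) (+ v) s t (g y (kept r)) (q y) p k))))
        (cong (_* c) (sym (trans he (ℤ.pos-* f v))))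
        where
        collect : ∀ f u v s t G q p k →
          q + - q * 1ℤ + v * (f * p) + s * (f * u * v * k)
          ≡ f * v * (s * u * k + p) + - q * (s * u + t * v) + v * (t * q - s * G) + s * (v * G + u * q)
        collect = solve-∀

    onto′ : ∀ τ → ∃[ y ] total y ≡ 0ℤ × Φ′ y T.≈ τ
    onto′ (p , γ , k , η) = y , total-y
      , 𝐙-≡ f (trans (cong₂ (λ q g → t * q - s * g) q≡ gk≡)
          (by-adding p bézout (collect-P (+ u) (+ v) s t p k)))
      , (λ i → 𝐙-≡ a (g≡ i))
      , 𝐙-≡ (f ℕ.* u ℕ.* v) (trans (cong₂ (λ q g → + v * g + + u * q) q≡ gk≡)
          (by-adding k bézout (collect-Q (+ u) (+ v) s t p k)))
      , (λ i → 𝐙-≡ ab (h≡ i))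
      where
      preimage : Σ[ y ∈ (Pair n → ℤ) ] total y ≡ 0ℤ × (∀ i → g y (outer r i) ≡ γ i)
        × g y (kept r) ≡ t * k - + u * p × (∀ i → h y i ≡ η i) × q y ≡ s * k + + v * p
      -- The prescribed values of `g` at `kept r` and of `q` are the inverse change of coordinates
      -- applied to `(p , k)`.
      preimage = attain γ (t * k - + u * p) η (s * k + + v * p)
      y : Pair n → ℤ
      y = proj₁ preimage
      total-y = proj₁ (proj₂ preimage)
      g≡ = proj₁ (proj₂ (proj₂ preimage))
      gk≡ = proj₁ (proj₂ (proj₂ (proj₂ preimage)))
      h≡ = proj₁ (proj₂ (proj₂ (proj₂ (proj₂ preimage))))
      q≡ = proj₂ (proj₂ (proj₂ (proj₂ (proj₂ preimage))))
      collect-P : ∀ u v s t p k → t * (s * k + v * p) - s * (t * k - u * p) + p * 1ℤ ≡ p + p * (s * u + t * v)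
      collect-P = solve-∀
      collect-Q : ∀ u v s t p k → v * (t * k - u * p) + u * (s * k + v * p) + k * 1ℤ ≡ k + k * (s * u + t * v)
      collect-Q = solve-∀

    private
      L : (KSubset n 2 → ℤ) → KSubset n 2 → ℤ
      L = GroupHomomorphism.⟦_⟧ (laplacian Γ)

      L≡Λ : ∀ x → L x ∘ toSubset ≗ Λ (+ a) (x ∘ toSubset)
      L≡Λ = laplacian-KG (+ a) ha

      Φ′-cong : ∀ {x y} → x ≗ y → Φ′ x T.≈ Φ′ y
      Φ′-cong x≗y = 𝐙-≡ f (congruent P-linear x≗y)
        , (λ i → 𝐙-≡ a (congruent (g-linear (outer r i)) x≗y))
        , 𝐙-≡ (f ℕ.* u ℕ.* v) (congruent Q-linear x≗y)
        , (λ i → 𝐙-≡ ab (congruent (h-linear i) x≗y))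

      Φ : Hom (ℤ^V Γ) T
      Φ = additive⇒Hom (ℤ^V Γ) T (λ y → Φ′ (y ∘ toSubset)) (λ x≗y → Φ′-cong (x≗y ∘ toSubset))
        λ x y → 𝐙-≡ f (additive P-linear (x ∘ toSubset) (y ∘ toSubset))
          , (λ i → 𝐙-≡ a (additive (g-linear (outer r i)) (x ∘ toSubset) (y ∘ toSubset)))
          , 𝐙-≡ (f ℕ.* u ℕ.* v) (additive Q-linear (x ∘ toSubset) (y ∘ toSubset))
          , (λ i → 𝐙-≡ ab (additive (h-linear i) (x ∘ toSubset) (y ∘ toSubset)))

      sumHom : Hom (ℤ^V Γ) ℤ.+-0-abelianGroup
      sumHom = additive⇒Hom (ℤ^V Γ) ℤ.+-0-abelianGroup (λ y → total (y ∘ toSubset))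
        (λ x≗y → congruent total-linear (x≗y ∘ toSubset))
        (λ x y → additive total-linear (x ∘ toSubset) (y ∘ toSubset))

      fromPairs : (Pair n → ℤ) → KSubset n 2 → ℤ
      fromPairs y v = y (fromSubset v)

      fromPairs-toSubset : ∀ y → fromPairs y ∘ toSubset ≗ y
      fromPairs-toSubset y e = cong y (fromSubset-toSubset e)

      exact : ∀ y → total (y ∘ toSubset) ≡ 0ℤ → Φ′ (y ∘ toSubset) T.≈ T.ε → ∃[ x ] y ≗ L x
      exact y total-y Φ≈ε = fromPairs x , λ w →
        subst (λ w → y w ≡ L (fromPairs x) w) (toSubset-fromSubset w) (at (fromSubset w))
        where
        preimage = exact′ (y ∘ toSubset) total-y Φ≈ε
        x : Pair n → ℤ
        x = proj₁ preimage
        at : ∀ ε → y (toSubset ε) ≡ L (fromPairs x) (toSubset ε)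
        at ε = trans (proj₂ preimage ε) (sym (trans (L≡Λ (fromPairs x) ε)
          (Λ-cong (+ a) (fromPairs-toSubset x) ε)))

      onto : ∀ τ → ∃[ y ] total (y ∘ toSubset) ≡ 0ℤ × Φ′ (y ∘ toSubset) T.≈ τ
      onto τ = fromPairs y
        , trans (congruent total-linear (fromPairs-toSubset y)) (proj₁ (proj₂ preimage))
        , T.trans {Φ′ (fromPairs y ∘ toSubset)} {Φ′ y} {τ} (Φ′-cong (fromPairs-toSubset y)) (proj₂ (proj₂ preimage))
        where
        preimage = onto′ τ
        y : Pair n → ℤ
        y = proj₁ preimage

      exponent : ℕ
      exponent = f ℕ.* (a ℕ.* (f ℕ.* u ℕ.* v ℕ.* ab))

      exponent-annihilates : exponent Annihilates T
      exponent-annihilates = annihilates-⊕ (𝐙 f) (𝐙 a ^ outerCount r ⊕ 𝐙 (f ℕ.* u ℕ.* v) ⊕ 𝐙 ab ^ M) {f} (annihilates-𝐙 f)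
        (annihilates-⊕ (𝐙 a ^ outerCount r) (𝐙 (f ℕ.* u ℕ.* v) ⊕ 𝐙 ab ^ M) {a} (annihilates-^ (𝐙 a) {a} (outerCount r) (annihilates-𝐙 a))
          (annihilates-⊕ (𝐙 (f ℕ.* u ℕ.* v)) (𝐙 ab ^ M) {f ℕ.* u ℕ.* v} (annihilates-𝐙 (f ℕ.* u ℕ.* v))
            (annihilates-^ (𝐙 ab) {ab} M (annihilates-𝐙 ab))))

      exponent≢0 : NonZero exponent
      exponent≢0 = ℕ.m*n≢0 f (a ℕ.* (fuv ℕ.* ab)) {{it}} {{ℕ.m*n≢0 a (fuv ℕ.* ab) {{a≢0}} {{ℕ.m*n≢0 fuv ab {{fuv≢0}} {{ab≢0}}}}}}
        where
        fuv : ℕ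
        fuv = f ℕ.* u ℕ.* v
        a≢0 : NonZero a
        a≢0 = ℕ.m*n≢0 f u
        fuv≢0 : NonZero fuv
        fuv≢0 = ℕ.m*n≢0 a v {{a≢0}}
        ab≢0 : NonZero ab
        -- `M + a` reduces to a successor, whereas `a + M` does not.
        ab≢0 = ℕ.m*n≢0 a (a ℕ.+ M) {{a≢0}} {{subst NonZero (ℕ.+-comm M a) _}}

    iso : criticalGroup (KG (5 ℕ.+ r) 2) ≅
      𝐙 f ⊕ 𝐙 (f ℕ.* u) ^ outerCount r ⊕ 𝐙 (f ℕ.* u ℕ.* v) ⊕ 𝐙 (f ℕ.* u ℕ.* (f ℕ.* u ℕ.+ (3 ℕ.+ r))) ^ (3 ℕ.+ r)
    iso = criticalGroup-≅ (KG (5 ℕ.+ r) 2)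
      (𝐙 f ⊕ 𝐙 (f ℕ.* u) ^ outerCount r ⊕ 𝐙 (f ℕ.* u ℕ.* v) ⊕ 𝐙 (f ℕ.* u ℕ.* (f ℕ.* u ℕ.+ (3 ℕ.+ r))) ^ (3 ℕ.+ r))
      sumHom Φ
      (λ x → trans (congruent total-linear (L≡Λ x)) (total-Λ (+ a) ha (x ∘ toSubset)))
      (λ x → T.trans {Φ′ (L x ∘ toSubset)} {Φ′ (Λ (+ a) (x ∘ toSubset))} {T.ε} (Φ′-cong (L≡Λ x)) (Φ′-Λ (x ∘ toSubset)))
      exact onto exponent {{exponent≢0}} exponent-annihilates

    private
      double-b : ∀ x → 2 ℕ.* x ≡ (4 ℕ.+ r) ℕ.* (1 ℕ.+ r) → (x ℕ.+ (3 ℕ.+ r)) ℕ.* 2 ≡ (2 ℕ.+ r) ℕ.* (5 ℕ.+ r)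
      double-b x two-x = trans (expand x r) (trans (cong (ℕ._+ 2 ℕ.* (3 ℕ.+ r)) two-x) (collect r))
        where
        expand : ∀ x r → (x ℕ.+ (3 ℕ.+ r)) ℕ.* 2 ≡ 2 ℕ.* x ℕ.+ 2 ℕ.* (3 ℕ.+ r)
        expand = ℕSolver.solve-∀
        collect : ∀ r → (4 ℕ.+ r) ℕ.* (1 ℕ.+ r) ℕ.+ 2 ℕ.* (3 ℕ.+ r) ≡ (2 ℕ.+ r) ℕ.* (5 ℕ.+ r)
        collect = ℕSolver.solve-∀

      quadruple : ∀ x y r → 2 ℕ.* x ≡ (4 ℕ.+ r) ℕ.* (1 ℕ.+ r) → y ℕ.* 2 ≡ (2 ℕ.+ r) ℕ.* (5 ℕ.+ r) →
        (1 ℕ.+ r) ℕ.* (4 ℕ.+ r) ℕ.* (2 ℕ.+ r) ℕ.* (5 ℕ.+ r) ≡ x ℕ.* y ℕ.* 4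
      quadruple x y r two-x two-y = trans (regroup (1 ℕ.+ r) (4 ℕ.+ r) (2 ℕ.+ r) (5 ℕ.+ r))
        (trans (cong₂ ℕ._*_ (sym two-x) (sym two-y)) (collect x y))
        where
        regroup : ∀ p q s t → p ℕ.* q ℕ.* s ℕ.* t ≡ (q ℕ.* p) ℕ.* (s ℕ.* t)
        regroup = ℕSolver.solve-∀
        collect : ∀ x y → (2 ℕ.* x) ℕ.* (y ℕ.* 2) ≡ x ℕ.* y ℕ.* 4
        collect = ℕSolver.solve-∀

    decomposition : ∀ n m₁ m₃ → n ≡ 5 ℕ.+ r → f ≡ m₁ → f ℕ.* u ℕ.* v ≡ m₃ →
      criticalGroup (KG n 2) ≅
        𝐙 m₁
        ⊕ 𝐙 ((n ℕ.∸ 4) ℕ.* (n ℕ.∸ 1) / 2) ^ (n ℕ.* (n ℕ.∸ 5) / 2)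
        ⊕ 𝐙 m₃
        ⊕ 𝐙 ((n ℕ.∸ 4) ℕ.* (n ℕ.∸ 1) ℕ.* (n ℕ.∸ 3) ℕ.* n / 4) ^ (n ℕ.∸ 2)
    decomposition n _ _ n≡ f≡m₁ fuv≡m₃ = relabel r f (f ℕ.* u) (outerCount r) (f ℕ.* u ℕ.* v) (f ℕ.* u ℕ.* (f ℕ.* u ℕ.+ (3 ℕ.+ r)))
      n≡ f≡m₁
      (≡-quotient (f ℕ.* u) 2 (trans n-4*n-1 (trans (ℕ.*-comm (1 ℕ.+ r) (4 ℕ.+ r)) (trans (sym two-fu) (ℕ.*-comm 2 (f ℕ.* u))))))
      (≡-quotient (outerCount r) 2 (trans (cong₂ ℕ._*_ n≡ (cong (ℕ._∸ 5) n≡)) (sym (outerCount-double r))))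
      fuv≡m₃
      (≡-quotient (f ℕ.* u ℕ.* (f ℕ.* u ℕ.+ (3 ℕ.+ r))) 4
        (trans (cong₂ ℕ._*_ (cong₂ ℕ._*_ n-4*n-1 (cong (ℕ._∸ 3) n≡)) n≡)
          (quadruple (f ℕ.* u) (f ℕ.* u ℕ.+ (3 ℕ.+ r)) r two-fu (double-b (f ℕ.* u) two-fu))))
      (sym (cong (ℕ._∸ 2) n≡))
      iso
      where
      n-4*n-1 : (n ℕ.∸ 4) ℕ.* (n ℕ.∸ 1) ≡ (1 ℕ.+ r) ℕ.* (4 ℕ.+ r)
      n-4*n-1 = cong₂ ℕ._*_ (cong (ℕ._∸ 4) n≡) (cong (ℕ._∸ 1) n≡)

  -- The two parities

  -- Here f = n - 4, u = (n - 1) / 2 and v = (n - 3) / 2. The last two are consecutive, so 1 and -1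
  -- are Bézout coefficients.
  odd-case : ∀ n k → n ≡ 5 ℕ.+ k ℕ.* 2 →
    criticalGroup (KG n 2) ≅
      𝐙 (n ℕ.∸ 4)
      ⊕ 𝐙 ((n ℕ.∸ 4) ℕ.* (n ℕ.∸ 1) / 2) ^ (n ℕ.* (n ℕ.∸ 5) / 2)
      ⊕ 𝐙 ((n ℕ.∸ 4) ℕ.* (n ℕ.∸ 1) ℕ.* (n ℕ.∸ 3) / 4)
      ⊕ 𝐙 ((n ℕ.∸ 4) ℕ.* (n ℕ.∸ 1) ℕ.* (n ℕ.∸ 3) ℕ.* n / 4) ^ (n ℕ.∸ 2)
  odd-case n k n≡ = Decomposition.decomposition (k ℕ.* 2) (1 ℕ.+ k ℕ.* 2) (2 ℕ.+ k) (1 ℕ.+ k)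
    1ℤ -1ℤ (bézout (+ k)) (two-fu k) (fv+fu k)
    n (n ℕ.∸ 4) ((n ℕ.∸ 4) ℕ.* (n ℕ.∸ 1) ℕ.* (n ℕ.∸ 3) / 4) n≡
    (sym (cong (ℕ._∸ 4) n≡))
    (≡-quotient ((1 ℕ.+ k ℕ.* 2) ℕ.* (2 ℕ.+ k) ℕ.* (1 ℕ.+ k)) 4
      (trans (cong₂ ℕ._*_ (cong₂ ℕ._*_ (cong (ℕ._∸ 4) n≡) (cong (ℕ._∸ 1) n≡)) (cong (ℕ._∸ 3) n≡)) (expand k)))
    where
    bézout : ∀ k → 1ℤ * (+ 2 + k) + -1ℤ * (+ 1 + k) ≡ 1ℤ
    bézout = solve-∀
    two-fu : ∀ k → 2 ℕ.* ((1 ℕ.+ k ℕ.* 2) ℕ.* (2 ℕ.+ k)) ≡ (4 ℕ.+ k ℕ.* 2) ℕ.* (1 ℕ.+ k ℕ.* 2)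
    two-fu = ℕSolver.solve-∀
    fv+fu : ∀ k → (1 ℕ.+ k ℕ.* 2) ℕ.* (2 ℕ.+ k) ℕ.+ 2 ≡ (1 ℕ.+ k ℕ.* 2) ℕ.* (1 ℕ.+ k) ℕ.+ (3 ℕ.+ k ℕ.* 2)
    fv+fu = ℕSolver.solve-∀
    expand : ∀ k → (1 ℕ.+ k ℕ.* 2) ℕ.* (4 ℕ.+ k ℕ.* 2) ℕ.* (2 ℕ.+ k ℕ.* 2) ≡ (1 ℕ.+ k ℕ.* 2) ℕ.* (2 ℕ.+ k) ℕ.* (1 ℕ.+ k) ℕ.* 4
    expand = ℕSolver.solve-∀

  -- Here f = (n - 4) / 2, u = n - 1 and v = n - 3. The last two are consecutive odd numbers, with
  -- Bézout coefficients -(n - 4) / 2 and (n - 2) / 2.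
  even-case : ∀ n k → n ≡ 6 ℕ.+ k ℕ.* 2 →
    criticalGroup (KG n 2) ≅
      𝐙 ((n ℕ.∸ 4) / 2)
      ⊕ 𝐙 ((n ℕ.∸ 4) ℕ.* (n ℕ.∸ 1) / 2) ^ (n ℕ.* (n ℕ.∸ 5) / 2)
      ⊕ 𝐙 ((n ℕ.∸ 4) ℕ.* (n ℕ.∸ 1) ℕ.* (n ℕ.∸ 3) / 2)
      ⊕ 𝐙 ((n ℕ.∸ 4) ℕ.* (n ℕ.∸ 1) ℕ.* (n ℕ.∸ 3) ℕ.* n / 4) ^ (n ℕ.∸ 2)
  even-case n k n≡ = Decomposition.decomposition (1 ℕ.+ k ℕ.* 2) (1 ℕ.+ k) (5 ℕ.+ k ℕ.* 2) (3 ℕ.+ k ℕ.* 2)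
    (- + (1 ℕ.+ k)) (+ (2 ℕ.+ k)) bézout (two-fu k) (fv+fu k)
    n ((n ℕ.∸ 4) / 2) ((n ℕ.∸ 4) ℕ.* (n ℕ.∸ 1) ℕ.* (n ℕ.∸ 3) / 2) n≡
    (≡-quotient (1 ℕ.+ k) 2 (cong (ℕ._∸ 4) n≡))
    (≡-quotient ((1 ℕ.+ k) ℕ.* (5 ℕ.+ k ℕ.* 2) ℕ.* (3 ℕ.+ k ℕ.* 2)) 2
      (trans (cong₂ ℕ._*_ (cong₂ ℕ._*_ (cong (ℕ._∸ 4) n≡) (cong (ℕ._∸ 1) n≡)) (cong (ℕ._∸ 3) n≡)) (expand k)))
    where
    bézout : - + (1 ℕ.+ k) * + (5 ℕ.+ k ℕ.* 2) + + (2 ℕ.+ k) * + (3 ℕ.+ k ℕ.* 2) ≡ 1ℤ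
    -- The cast of `k * 2` does not reduce to a product of integers, so it is rewritten before the
    -- ring identity applies.
    bézout = trans (cong (λ c → - + (1 ℕ.+ k) * (+ 5 + c) + + (2 ℕ.+ k) * (+ 3 + c)) (ℤ.pos-* k 2)) (cancel (+ k))
      where
      cancel : ∀ k → - (+ 1 + k) * (+ 5 + k * + 2) + (+ 2 + k) * (+ 3 + k * + 2) ≡ 1ℤ
      cancel = solve-∀
    two-fu : ∀ k → 2 ℕ.* ((1 ℕ.+ k) ℕ.* (5 ℕ.+ k ℕ.* 2)) ≡ (5 ℕ.+ k ℕ.* 2) ℕ.* (2 ℕ.+ k ℕ.* 2)
    two-fu = ℕSolver.solve-∀
    fv+fu : ∀ k → (1 ℕ.+ k) ℕ.* (5 ℕ.+ k ℕ.* 2) ℕ.+ 2 ≡ (1 ℕ.+ k) ℕ.* (3 ℕ.+ k ℕ.* 2) ℕ.+ (4 ℕ.+ k ℕ.* 2)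
    fv+fu = ℕSolver.solve-∀
    expand : ∀ k → (2 ℕ.+ k ℕ.* 2) ℕ.* (5 ℕ.+ k ℕ.* 2) ℕ.* (3 ℕ.+ k ℕ.* 2) ≡ (1 ℕ.+ k) ℕ.* (5 ℕ.+ k ℕ.* 2) ℕ.* (3 ℕ.+ k ℕ.* 2) ℕ.* 2
    expand = ℕSolver.solve-∀

  odd-form : ∀ {n} → 5 ℕ.≤ n → 2 ∤ n → ∃[ k ] n ≡ 5 ℕ.+ k ℕ.* 2
  odd-form 5≤n 2∤n with ℕ.m≤n⇒∃[o]m+o≡n 5≤n
  ... | r , refl with even⊎odd r
  ...   | inj₁ (k , refl) = k , refl
  ...   | inj₂ (k , refl) = contradiction (divides (3 ℕ.+ k) refl) 2∤n

  even-form : ∀ {n} → 5 ℕ.≤ n → 2 ∣ n → ∃[ k ] n ≡ 6 ℕ.+ k ℕ.* 2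
  even-form 5≤n 2∣n with ℕ.m≤n⇒∃[o]m+o≡n 5≤n
  ... | r , refl with even⊎odd r
  ...   | inj₁ (k , refl) = contradiction 2∣n (2∤1+even (2 ℕ.+ k))
  ...   | inj₂ (k , refl) = k , refl

open import Data.Nat.Base using (_≤_; _+_; _*_; _∸_)

theorem4p1 : ∀ (n : ℕ) → 5 ≤ n →
    (2 ∤ n →
    criticalGroup (KG n 2) ≅
    𝐙 (n ∸ 4)
    ⊕ 𝐙 ((n ∸ 4) * (n ∸ 1) / 2) ^ (n * (n ∸ 5) / 2)
    ⊕ 𝐙 ((n ∸ 4) * (n ∸ 1) * (n ∸ 3) / 4)
    ⊕ 𝐙 ((n ∸ 4) * (n ∸ 1) * (n ∸ 3) * n / 4) ^ (n ∸ 2))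
    ×
    (2 ∣ n →
    criticalGroup (KG n 2) ≅
    𝐙 ((n ∸ 4) / 2)
    ⊕ 𝐙 ((n ∸ 4) * (n ∸ 1) / 2) ^ (n * (n ∸ 5) / 2)
    ⊕ 𝐙 ((n ∸ 4) * (n ∸ 1) * (n ∸ 3) / 2)
    ⊕ 𝐙 ((n ∸ 4) * (n ∸ 1) * (n ∸ 3) * n / 4) ^ (n ∸ 2))
theorem4p1 n 5≤n =
    (λ 2∤n → let (k , n≡) = odd-form 5≤n 2∤n in odd-case n k n≡)
  , (λ 2∣n → let (k , n≡) = even-form 5≤n 2∣n in even-case n k n≡)
  where open KneserLaplacian
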